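{- Let $p$ be an odd prime, let $d>1$ be an integer, and let $q$ be an even power of $p$ with $q \equiv 1 \pmod{2d}$. Then the clique number of the generalized Paley graph $GP(q,d)$ satisfies $\omega\big(GP(q,d)\big)=\sqrt{q}$ if and only if $d \mid (\sqrt{q}+1)$. In particular, if $d \nmid (\sqrt{q}+1)$, then $\omega\big(GP(q,d)\big) \leq \sqrt{q}-1$.
   Context: For a prime power $q$ and an integer $d>1$ with $d \mid q-1$, the $d$-Paley graph $GP(q,d)$ is the graph with vertex set $\mathbb{F}_q$ in which two distinct vertices $x,y$ are adjacent if and only if $x-y$ is a $d$-th power in $\mathbb{F}_q^*$. $\omega(X)$ denotes the clique number (size of a largest clique) of a graph $X$. -}

module Defs where

open import Algebra.Bundles using (CommutativeRing)
import Algebra.Properties.Semiring.Exp as Exp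
open import Data.Fin.Base using (Fin; finToFun; funToFin)
import Data.Fin.Properties as Fin
open import Data.Nat.Base using (ℕ; zero; suc; _≤_; _^_)
import Data.Nat.Properties as ℕ
open import Data.Product.Base using (∃; _×_; _,_; proj₁; proj₂)
open import Function.Bundles using (Inverse; Injection)
open import Level using (Level; _⊔_)
import Level
open import Relation.Binary.Bundles using (Setoid)
open import Relation.Binary.Core using (Rel)
open import Relation.Binary.Definitions using (Decidable; Irreflexive; _Respects₂_)
open import Relation.Binary.PropositionalEquality as ≡ using (_≡_; _≢_; refl; subst₂; setoid)
open import Relation.Nullary.Decidable using (Dec; yes; no; map′; ¬?; _×-dec_; _→-dec_)
open import Relation.Nullary.Negation using (¬_; contradiction)

private
  variable
    c ℓ a : Level
    q : ℕ

-- A field with exactly q elements (counted up to ≈).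
record FiniteField (q : ℕ) (c ℓ : Level) : Set (Level.suc (c ⊔ ℓ)) where
  field
    commutativeRing : CommutativeRing c ℓ
  open CommutativeRing commutativeRing public renaming (setoid to setoidF; refl to ≈-refl)
  field
    1≉0         : ¬ (1# ≈ 0#)
    inverse     : ∀ x → ¬ (x ≈ 0#) → ∃ λ y → x * y ≈ 1#
    enumeration : Inverse (setoid (Fin q)) setoidF

-- Symmetry of Adj is not required, because x - y being a d-th power is a
-- symmetric condition only when -1 is a d-th power (as it is when 2d ∣ q - 1).
-- Cliques below demand adjacency for both orderings of every pair.
record FiniteGraph (c ℓ a : Level) : Set (Level.suc (c ⊔ ℓ ⊔ a)) where
  field
    vertices : Setoid c ℓ
  open Setoid vertices public using () renaming (Carrier to V; _≈_ to _≈ᵥ_)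
  field
    order       : ℕ
    enumeration : Inverse (setoid (Fin order)) vertices
    Adj         : Rel V a
    Adj-resp    : Adj Respects₂ _≈ᵥ_
    Adj-irrefl  : Irreflexive _≈ᵥ_ Adj
    Adj?        : Decidable Adj

module _ (G : FiniteGraph c ℓ a) where
  open FiniteGraph G

  record Clique (m : ℕ) : Set (c ⊔ ℓ ⊔ a) where
    field
      members  : Injection (setoid (Fin m)) vertices
      adjacent : ∀ i j → i ≢ j → Adj (Injection.to members i) (Injection.to members j)

  IsCliqueNumber : ℕ → Set (c ⊔ ℓ ⊔ a)
  IsCliqueNumber w = Clique w × (∀ m → Clique m → m ≤ w)

  private
    module E = Inverse enumeration
    module S = Setoid vertices

    enum-index : ∀ v → E.to (E.from v) ≈ᵥ v
    enum-index v = E.strictlyInverseˡ v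

    PairwiseAdj : ∀ {m} → (Fin m → Fin order) → Set a
    PairwiseAdj f = ∀ i j → i ≢ j → Adj (E.to (f i)) (E.to (f j))

    toClique : ∀ {m} (f : Fin m → Fin order) → PairwiseAdj f → Clique m
    toClique f adj = record
      { members = record
        { to        = λ i → E.to (f i)
        ; cong      = λ { refl → S.refl }
        ; injective = inj _ _
        }
      ; adjacent = adj
      }
      where
      inj : ∀ i j → E.to (f i) ≈ᵥ E.to (f j) → i ≡ j
      inj i j eq with i Fin.≟ j
      ... | yes i≡j = i≡j
      ... | no  i≢j = contradiction (adj i j i≢j) (Adj-irrefl eq)

    fromClique : ∀ {m} → Clique m → ∃ λ (k : Fin (order ^ m)) → PairwiseAdj (finToFun {order} {m} k)
    fromClique {m} C = funToFin f , λ i j i≢j →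
      subst₂ (λ u v → Adj (E.to u) (E.to v))
        (≡.sym (Fin.finToFun-funToFin f i)) (≡.sym (Fin.finToFun-funToFin f j))
        (proj₁ Adj-resp (S.sym (enum-index _))
          (proj₂ Adj-resp (S.sym (enum-index _)) (Clique.adjacent C i j i≢j)))
      where
      f : Fin m → Fin order
      f i = E.from (Injection.to (Clique.members C) i)

    clique? : ∀ m → Dec (Clique m)
    clique? m = map′ (λ (k , adj) → toClique (finToFun {order} {m} k) adj) fromClique
      (Fin.any? λ k → Fin.all? λ i → Fin.all? λ j →
        ¬? (i Fin.≟ j) →-dec Adj? (E.to (finToFun {order} {m} k i)) (E.to (finToFun {order} {m} k j)))

    clique≤order : ∀ m → Clique m → m ≤ order
    clique≤order m C = Fin.injective⇒≤ {f = λ i → E.from (to i)} λ {i} {j} eq →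
      injective (S.trans (S.sym (enum-index (to i)))
        (S.trans (S.reflexive (≡.cong E.to eq)) (enum-index (to j))))
      where open Injection (Clique.members C)

    search : ∀ n → (∀ m → Clique m → m ≤ n) → ∃ IsCliqueNumber
    search zero bound = 0 , toClique (λ ()) (λ ()) , bound
    search (suc n) bound with clique? (suc n)
    ... | yes C = suc n , C , bound
    ... | no ¬C = search n λ m C → ℕ.≤-pred (ℕ.≤∧≢⇒< (bound m C) λ { refl → ¬C C })

  cliqueNumber : ∃ IsCliqueNumber
  cliqueNumber = search order clique≤order

  ω : ℕ
  ω = proj₁ cliqueNumber

  ω-isCliqueNumber : IsCliqueNumber ω
  ω-isCliqueNumber = proj₂ cliqueNumber

module _ (F : FiniteField q c ℓ) where
  open FiniteField F
  open Exp semiring using (^-congˡ) renaming (_^_ to _^ᶠ_)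

  IsUnitPower : ℕ → Carrier → Set (c ⊔ ℓ)
  IsUnitPower d x = ∃ λ z → ¬ (z ≈ 0#) × x ≈ z ^ᶠ d

  PaleyAdj : ℕ → Rel Carrier (c ⊔ ℓ)
  PaleyAdj d x y = ¬ (x ≈ y) × IsUnitPower d (x - y)

  private
    module E = Inverse enumeration

    _≈?_ : Decidable _≈_
    x ≈? y = map′
      (λ eq → trans (sym (E.strictlyInverseˡ x))
        (trans (reflexive (≡.cong E.to eq)) (E.strictlyInverseˡ y)))
      E.from-cong (E.from x Fin.≟ E.from y)

    isUnitPower? : ∀ d x → Dec (IsUnitPower d x)
    isUnitPower? d x = map′
      (λ (i , z≉0 , eq) → E.to i , z≉0 , eq)
      (λ (z , z≉0 , eq) → E.from z
        , (λ z≈0 → z≉0 (trans (sym (E.strictlyInverseˡ z)) z≈0))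
        , trans eq (^-congˡ d (sym (E.strictlyInverseˡ z))))
      (Fin.any? λ i → ¬? (E.to i ≈? 0#) ×-dec (x ≈? (E.to i ^ᶠ d)))

    paleyAdj-resp : ∀ d {x x′ y y′} → x ≈ x′ → y ≈ y′ → PaleyAdj d x y → PaleyAdj d x′ y′
    paleyAdj-resp d x≈x′ y≈y′ (x≉y , z , z≉0 , eq) =
      (λ x′≈y′ → x≉y (trans x≈x′ (trans x′≈y′ (sym y≈y′))))
      , z , z≉0 , trans (sym (+-cong x≈x′ (-‿cong y≈y′))) eq

  GP : ℕ → FiniteGraph c ℓ (c ⊔ ℓ)
  GP d = record
    { vertices    = setoidF
    ; order       = q
    ; enumeration = enumeration
    ; Adj         = PaleyAdj d
    ; Adj-resp    = paleyAdj-resp d ≈-refl , λ x≈x′ → paleyAdj-resp d x≈x′ ≈-refl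
    ; Adj-irrefl  = λ x≈y (x≉y , _) → x≉y x≈y
    ; Adj?        = λ x y → ¬? (x ≈? y) ×-dec isUnitPower? d (x - y)
    }

{-# OPTIONS --safe #-}
-- Write s = √q and h = (q - 1) / d, so that x ^ h = 1 for every nonzero d-th power x.
--
-- Let A be a clique with M ≥ s elements, let m = s - (h mod s), and let B ⊆ A have m elements.
-- The polynomial f(X) = H_h(X - b : b ∈ B) - 1, where H_h is the complete homogeneous symmetric
-- polynomial, has degree h: its leading coefficient C(h + m - 1, h) is prime to p, because
-- s ∣ h + m and m - 1 < s = pⁿ.  Its Hasse derivatives at a are multiples of H_{h - j}(a - b : b ∈ B),
-- which are divided differences of powers x ^ (h + i) over points with x ^ h = 1 (or x = 0).
-- Since x ^ (h + i) = x ^ i there, f vanishes to order m at the points of A outside B and to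
-- order m - 1 at those of B.  Counting roots, m (M - 1) ≤ h, i.e. d m (M - 1) ≤ (s - 1) (s + 1).
-- As d h ≡ -1 mod s we have d m ≡ 1 mod s, and d m > 1, which forces M = s and d m = s + 1.
--
-- Conversely, if d ∣ s + 1, the s solutions of x ^ s = x are closed under subtraction, and the
-- nonzero ones are (s + 1)-th powers, hence d-th powers; so they form a clique.
module Submission where

open import Defs
open import Data.Nat.Base using (ℕ; _+_; _*_; _∸_; _^_; _≤_; _<_; ∣_-_∣)
open import Data.Nat.Divisibility using (_∣_)
open import Data.Nat.Primality using (Prime)
open import Data.Product.Base using (∃; _×_)
open import Function.Bundles using (_⇔_)
open import Level using (Level)
open import Relation.Binary.PropositionalEquality using (_≡_)
open import Relation.Nullary.Negation using (¬_)

import Algebra.Properties.CommutativeMonoid.Sum as Sum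
import Algebra.Properties.CommutativeSemiring.Binomial as Binomial
import Algebra.Properties.CommutativeSemiring.Exp as Exp
import Algebra.Properties.Group as Group
import Algebra.Properties.Semiring.Mult as Mult
import Algebra.Solver.Ring.NaturalCoefficients.Default as Solver
open import Data.Fin.Base using (Fin; zero; suc; _↑ˡ_; _↑ʳ_; splitAt; punchIn; toℕ; fromℕ; inject₁; inject≤)
open import Data.Fin.Permutation using (Permutation; permutation; _⟨$⟩ʳ_; remove; punchIn-permute)
import Data.Fin.Properties as Fin
open import Data.List.Base using (List; []; _∷_; map; length; lookup; tabulate; allFin; filter; _++_)
open import Data.List.Membership.Propositional.Properties using (∈-lookup)
open import Data.List.Properties using (length-map; length-tabulate; map-++)
open import Data.List.Relation.Unary.All using (All; []; _∷_)
import Data.List.Relation.Unary.All as All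
import Data.List.Relation.Unary.All.Properties as All
open import Data.List.Relation.Unary.AllPairs using (AllPairs; []; _∷_)
import Data.List.Relation.Unary.AllPairs as AllPairs
import Data.List.Relation.Unary.AllPairs.Properties as AllPairs
open import Data.List.Relation.Unary.Unique.Propositional using (Unique)
import Data.List.Relation.Unary.Unique.Propositional.Properties as Unique
open import Data.Nat.Base using (zero; suc; pred; z≤n; s≤s; s<s; s≤s⁻¹; NonZero; >-nonZero; ≢-nonZero⁻¹)
open import Data.Nat.Combinatorics using (_C_; nCn≡1; nC1≡n; nCk≡nC[n∸k]; nCk+nC[k+1]≡[n+1]C[k+1]; k>n⇒nCk≡0)
open import Data.Nat.Coprimality using (Coprime; coprime-Bézout)
open import Data.Nat.DivMod using (_/_; _%_; m≡m%n+[m/n]*n; m%n<n)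
open import Data.Nat.Divisibility using (divides; _∣?_; ∣-reflexive; ∣-trans; ∣⇒≤; ∣m+n∣m⇒∣n; m∣m*n; *-monoʳ-∣; *-cancelˡ-∣; ∣m⇒∣m*n; ∣1⇒≡1; 1∣_; _∣0)
open import Data.Nat.GCD using (module Bézout)
open import Data.Nat.ListAction using (sum)
open import Data.Nat.ListAction.Properties using (sum-++)
open import Data.Nat.Primality using (euclidsLemma; prime⇒irreducible; prime⇒nonZero; ¬prime[1])
import Data.Nat.Properties as ℕ
open import Data.Nat.Tactic.RingSolver using (solve-∀)
open import Data.Product.Base using (_,_; proj₁; proj₂)
open import Data.Sum.Base using (inj₁; inj₂)
open import Data.Vec.Base using (Vec; []; _∷_; zipWith; replicate)
open import Function.Bundles using (Inverse; Injection; mk⇔)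
import Relation.Binary.Definitions as Binary
open import Relation.Binary.PropositionalEquality as ≡ using (_≢_; cong; cong₂; subst; subst₂)
import Relation.Binary.Reasoning.Setoid as Reasoning
open import Relation.Nullary.Decidable using (yes; no; ¬?; map′; decidable-stable)
open import Relation.Nullary.Negation using (contradiction)
open import Relation.Unary using (Pred; Decidable)

-- Binomial coefficients modulo a prime.

nC0≡1 : ∀ n → n C 0 ≡ 1
nC0≡1 n = ≡.trans (nCk≡nC[n∸k] {n = n} z≤n) (nCn≡1 n)

-- Induction through Pascal's rule. It carries a prime power dividing the upper index over to the
-- product of the lower index and the coefficient.
absorption : ∀ n k → suc k * (suc n C suc k) ≡ suc n * (n C k)
absorption zero zero = ≡.refl
absorption zero (suc k) = ≡.trans
  (cong (suc (suc k) *_) (k>n⇒nCk≡0 {1} {suc (suc k)} (s<s ℕ.0<1+n)))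
  (≡.trans (ℕ.*-zeroʳ (suc (suc k))) (≡.sym (cong (1 *_) (k>n⇒nCk≡0 {0} {suc k} ℕ.0<1+n))))
absorption (suc n) zero = ≡.trans (ℕ.*-identityˡ _)
  (≡.trans (nC1≡n (suc (suc n))) (≡.trans (≡.sym (ℕ.*-identityʳ _)) (cong (suc (suc n) *_) (≡.sym (nC0≡1 (suc n))))))
absorption (suc n) (suc k) = begin
  suc (suc k) * (suc (suc n) C suc (suc k))          ≡⟨ cong (suc (suc k) *_) (pascal (suc n) (suc k)) ⟨
  suc (suc k) * (x + (suc n C suc (suc k)))          ≡⟨ ℕ.*-distribˡ-+ (suc (suc k)) x _ ⟩
  (x + suc k * x) + suc (suc k) * (suc n C suc (suc k)) ≡⟨ cong₂ (λ u v → (x + u) + v) (absorption n k) (absorption n (suc k)) ⟩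
  (x + suc n * (n C k)) + suc n * (n C suc k)        ≡⟨ ℕ.+-assoc x _ _ ⟩
  x + (suc n * (n C k) + suc n * (n C suc k))        ≡⟨ cong (x +_) (ℕ.*-distribˡ-+ (suc n) (n C k) _) ⟨
  x + suc n * ((n C k) + (n C suc k))                ≡⟨ cong (λ y → x + suc n * y) (pascal n k) ⟩
  suc (suc n) * x                                    ∎
  where
  open ≡.≡-Reasoning
  pascal = nCk+nC[k+1]≡[n+1]C[k+1]
  x = suc n C suc k

module _ {p : ℕ} (pr : Prime p) where

  private instance
    p≢0 : NonZero p
    p≢0 = prime⇒nonZero pr

  ∤⇒p^n∣ : ∀ n {a b} → ¬ (p ∣ b) → p ^ n ∣ a * b → p ^ n ∣ a
  ∤⇒p^n∣ zero p∤b _ = 1∣ _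
  ∤⇒p^n∣ (suc n) {a} {b} p∤b div with euclidsLemma a b pr (∣-trans (m∣m*n (p ^ n)) div)
  ... | inj₂ p∣b = contradiction p∣b p∤b
  ... | inj₁ (divides a′ ≡.refl) = subst (p ^ suc n ∣_) (ℕ.*-comm p a′)
    (*-monoʳ-∣ p (∤⇒p^n∣ n p∤b (*-cancelˡ-∣ p
      (subst (p ^ suc n ∣_) (≡.trans (cong (_* b) (ℕ.*-comm a′ p)) (ℕ.*-assoc p a′ b)) div))))

  -- By `absorption`, `p ^ n` divides `k * (N C k)`. If `p` did not divide `N C k`, the whole power
  -- would divide `k`, which is positive and too small.
  p∣C : ∀ n N k → p ^ n ∣ N → 0 < k → k < p ^ n → p ∣ N C k
  p∣C n zero (suc k) _ _ _ = subst (p ∣_) (≡.sym (k>n⇒nCk≡0 {0} {suc k} ℕ.0<1+n)) (p ∣0)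
  p∣C n (suc N) (suc k) div _ k<pⁿ = decidable-stable (p ∣? _) λ p∤C →
    ℕ.<⇒≱ k<pⁿ (∣⇒≤ (∤⇒p^n∣ n p∤C (subst (p ^ n ∣_) (≡.sym (absorption N k)) (∣m⇒∣m*n (N C k) div))))

  -- Pascal's rule and `p∣C` make consecutive coefficients negatives of each other modulo `p`, so
  -- all of them are ±1, starting from `N C 0`.
  p∤C : ∀ n N k → p ^ n ∣ suc N → k < p ^ n → ¬ (p ∣ N C k)
  p∤C n N zero _ _ p∣1 = ¬prime[1] (subst Prime (∣1⇒≡1 (subst (p ∣_) (nC0≡1 N) p∣1)) pr)
  p∤C n N (suc k) div k<pⁿ p∣C′ = p∤C n N k div (ℕ.<-trans (ℕ.n<1+n k) k<pⁿ)
    (∣m+n∣m⇒∣n (subst (p ∣_)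
      (≡.trans (≡.sym (nCk+nC[k+1]≡[n+1]C[k+1] N k)) (ℕ.+-comm (N C k) _))
      (p∣C n (suc N) (suc k) div ℕ.0<1+n k<pⁿ)) p∣C′)

-- Selecting from lists, and arithmetic of natural numbers.

length-filter+length-filter-¬ : ∀ {a p} {A : Set a} {P : Pred A p} (P? : Decidable P) (xs : List A) →
  length (filter P? xs) + length (filter (λ x → ¬? (P? x)) xs) ≡ length xs
length-filter+length-filter-¬ P? [] = ≡.refl
length-filter+length-filter-¬ P? (x ∷ xs) with P? x
... | yes _ = cong suc (length-filter+length-filter-¬ P? xs)
... | no  _ = ≡.trans (ℕ.+-suc _ _) (cong suc (length-filter+length-filter-¬ P? xs))

lookup-injective : ∀ {a} {A : Set a} {xs : List A} → Unique xs → ∀ i j → lookup xs i ≡ lookup xs j → i ≡ j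
lookup-injective (_ ∷ _) zero zero _ = ≡.refl
lookup-injective {xs = _ ∷ xs} (x∉ ∷ _) zero (suc j) eq = contradiction eq (All.lookup x∉ (∈-lookup j))
lookup-injective {xs = _ ∷ xs} (x∉ ∷ _) (suc i) zero eq = contradiction (≡.sym eq) (All.lookup x∉ (∈-lookup i))
lookup-injective (_ ∷ unique) (suc i) (suc j) eq = cong suc (lookup-injective unique i j eq)

distinct-members : ∀ {a p} {A : Set a} {P : Pred A p} {m} (xs : List A) → Unique xs → All P xs → m ≤ length xs →
  ∃ λ (f : Fin m → A) → (∀ i j → f i ≡ f j → i ≡ j) × (∀ i → P (f i))
distinct-members xs unique all m≤len =
  (λ i → lookup xs (inject≤ i m≤len)) ,
  (λ i j eq → Fin.inject≤-injective m≤len m≤len i j (lookup-injective unique _ _ eq)) ,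
  (λ i → All.lookup all (∈-lookup (inject≤ i m≤len)))

square-injective : ∀ {m n} → m * m ≡ n * n → m ≡ n
square-injective {m} {n} eq = ℕ.≤-antisym
  (ℕ.≮⇒≥ λ n<m → ℕ.<-irrefl (≡.sym eq) (ℕ.*-mono-< n<m n<m))
  (ℕ.≮⇒≥ λ m<n → ℕ.<-irrefl eq (ℕ.*-mono-< m<n m<n))

-- Here `suc k` is `s - h % s`, the size of the set B. When `s` divides `h` it is `s` rather than 0,
-- so B is never empty.
∃-complement : ∀ h s → 0 < s → ∃ λ k → ∃ λ t → k < s × h + suc k ≡ t * s
∃-complement h s@(suc _) _ with k , eq ← ℕ.m≤n⇒∃[o]m+o≡n (m%n<n h s) =
  k , suc (h / s) , subst (k <_) eq (s≤s (ℕ.m≤n+m k _)) , (begin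
    h + suc k                    ≡⟨ cong (_+ suc k) (m≡m%n+[m/n]*n h s) ⟩
    h % s + h / s * s + suc k    ≡⟨ rearrange (h % s) (h / s * s) k ⟩
    suc (h % s) + k + h / s * s  ≡⟨ cong (_+ h / s * s) eq ⟩
    s + h / s * s                ∎)
  where
  open ≡.≡-Reasoning
  rearrange : ∀ r t k → r + t + suc k ≡ suc r + k + t
  rearrange = solve-∀

-- d (k + 1) ≡ 1 mod s, so d (k + 1) exceeds 1 by a positive multiple of s;
-- the bound (k + 1) (M - 1) ≤ (s² - 1) / d leaves only M = s and d (k + 1) = s + 1.
extremal-arithmetic : ∀ {d h s k t l} → 1 < d → 1 < s → suc (h * d) ≡ s * s → h + suc k ≡ t * s →
  suc k * (k + l) ≤ h → s ≤ suc k + l → suc k + l ≡ s × d ∣ suc s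
extremal-arithmetic {d} {h} {s@(suc r)} {k} {t} {l} 1<d (s≤s 0<r) order complement bound s≤M =
  conclude u (ℕ.+-cancelʳ-≡ (s * s) _ _ (begin
      suc k * d + s * s      ≡⟨ congruence ⟩
      suc (t * d * s)        ≡⟨ cong (λ x → suc (x * s)) (ℕ.m+[n∸m]≡n s≤td) ⟨
      suc ((s + u) * s)      ≡⟨ split s u ⟩
      suc (u * s) + s * s    ∎))
  where
  open ≡.≡-Reasoning

  congruence : suc k * d + s * s ≡ suc (t * d * s)
  congruence = begin
    suc k * d + s * s          ≡⟨ cong (suc k * d +_) order ⟨
    suc k * d + suc (h * d)    ≡⟨ factor (suc k) h d ⟩
    suc ((h + suc k) * d)      ≡⟨ cong (λ x → suc (x * d)) complement ⟩
    suc (t * s * d)            ≡⟨ cong suc (swap t s d) ⟩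
    suc (t * d * s)            ∎
    where
    factor : ∀ k h d → k * d + suc (h * d) ≡ suc ((h + k) * d)
    factor = solve-∀
    swap : ∀ t s d → t * s * d ≡ t * d * s
    swap = solve-∀

  split : ∀ s u → suc ((s + u) * s) ≡ suc (u * s) + s * s
  split = solve-∀

  1<[1+k]*d : 1 < suc k * d
  1<[1+k]*d = ℕ.<-≤-trans 1<d (ℕ.m≤m+n d (k * d))

  -- If `t * d < s`, then `congruence` would leave at most 1 for `suc k * d`. Hence the truncated
  -- difference `u` is exact.
  s≤td : s ≤ t * d
  s≤td = ℕ.≮⇒≥ λ td<s → ℕ.<⇒≱ 1<[1+k]*d (ℕ.+-cancelʳ-≤ (t * d * s) _ _ (ℕ.≤-trans
    (ℕ.+-monoʳ-≤ (suc k * d) (ℕ.*-monoˡ-≤ s (ℕ.<⇒≤ td<s))) (ℕ.≤-reflexive congruence)))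

  h*d≡ : h * d ≡ r * suc s
  h*d≡ = ℕ.suc-injective (≡.trans order (square r))
    where
    square : ∀ r → suc r * suc r ≡ suc (r * suc (suc r))
    square = solve-∀

  u = t * d ∸ s

  conclude : ∀ u → suc k * d ≡ suc (u * s) → suc k + l ≡ s × d ∣ suc s
  conclude zero    eq = contradiction eq (ℕ.>⇒≢ 1<[1+k]*d)
  conclude (suc w) eq = cong suc k+l≡r , divides (suc k) (≡.sym (≡.trans eq
    (cong suc (≡.trans (cong (s +_) ws≡0) (ℕ.+-identityʳ s)))))
    where
    r≤k+l : r ≤ k + l
    r≤k+l = s≤s⁻¹ s≤M

    -- This is `bound` times `d`, with `suc k * d` equal to `suc s + w * s` and `h * d` equal to
    -- `r * suc s`. As `k + l` is at least `r`, it forces both `k + l ≡ r` and `w * s ≡ 0`.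
    scaled : (k + l) * (suc s + w * s) ≤ r * suc s
    scaled = subst₂ _≤_ (≡.trans (rearrange (suc k) (k + l) d) (cong ((k + l) *_) eq)) h*d≡ (ℕ.*-monoˡ-≤ d bound)
      where
      rearrange : ∀ k m d → k * m * d ≡ m * (k * d)
      rearrange = solve-∀

    k+l≡r : k + l ≡ r
    k+l≡r = ℕ.≤-antisym (ℕ.*-cancelʳ-≤ (k + l) r (suc s)
      (ℕ.≤-trans (ℕ.*-monoʳ-≤ (k + l) (ℕ.m≤m+n (suc s) (w * s))) scaled)) r≤k+l

    ws≡0 : w * s ≡ 0
    ws≡0 = ℕ.n≤0⇒n≡0 (ℕ.+-cancelˡ-≤ (suc s) _ _ (ℕ.≤-trans
      (ℕ.*-cancelˡ-≤ r {{>-nonZero 0<r}} (ℕ.≤-trans (ℕ.*-monoˡ-≤ _ r≤k+l) scaled))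
      (ℕ.≤-reflexive (≡.sym (ℕ.+-identityʳ (suc s))))))

-- Hasse derivatives, roots with multiplicity, and divided differences.

module Polynomials {q : ℕ} {c ℓ : Level} (F : FiniteField q c ℓ) where
  open FiniteField F hiding (zero) renaming (_+_ to infixl 6 _+ᶠ_; _*_ to infixl 7 _*ᶠ_; _-_ to infixl 6 _-ᶠ_)
  open Exp commutativeSemiring using () renaming (_^_ to infixr 8 _^ᶠ_)
  open Mult semiring using (×-homo-+) renaming (_×_ to _×ᶠ_)
  open Group +-group using () renaming (x∙y⁻¹≈ε⇒x≈y to x-y≈0⇒x≈y; ∙-cancelʳ to +-cancelʳ)
  open Solver commutativeSemiring using (solve; _:+_; _:*_; _:=_; con)
  open Reasoning setoidF

  *-cancelˡ-≉0 : ∀ {x y z} → ¬ (x ≈ 0#) → x *ᶠ y ≈ x *ᶠ z → y ≈ z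
  *-cancelˡ-≉0 {x} {y} {z} x≉0 eq with x⁻¹ , xx⁻¹≈1 ← inverse x x≉0 = begin
    y                ≈⟨ lemma y ⟨
    x⁻¹ *ᶠ (x *ᶠ y)  ≈⟨ *-congˡ eq ⟩
    x⁻¹ *ᶠ (x *ᶠ z)  ≈⟨ lemma z ⟩
    z                ∎
    where
    lemma : ∀ w → x⁻¹ *ᶠ (x *ᶠ w) ≈ w
    lemma w = begin
      x⁻¹ *ᶠ (x *ᶠ w)  ≈⟨ solve 3 (λ a b d → a :* (b :* d) := (b :* a) :* d) ≈-refl x⁻¹ x w ⟩
      (x *ᶠ x⁻¹) *ᶠ w  ≈⟨ *-congʳ xx⁻¹≈1 ⟩
      1# *ᶠ w          ≈⟨ *-identityˡ w ⟩
      w                ∎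

  x*y≈0⇒y≈0 : ∀ {x y} → ¬ (x ≈ 0#) → x *ᶠ y ≈ 0# → y ≈ 0#
  x*y≈0⇒y≈0 {x} x≉0 eq = *-cancelˡ-≉0 x≉0 (trans eq (sym (zeroʳ x)))

  x-y+y≈x : ∀ x y → (x -ᶠ y) +ᶠ y ≈ x
  x-y+y≈x x y = trans (+-assoc x (- y) y) (trans (+-congˡ (-‿inverseˡ y)) (+-identityʳ x))

  -- A polynomial is the vector of its coefficients, constant term first;
  -- D j a v is its j-th Hasse derivative at a, so D 0 a v is its value.
  D : ∀ {n} → ℕ → Carrier → Vec Carrier n → Carrier
  D j       a []      = 0#
  D zero    a (x ∷ v) = x +ᶠ a *ᶠ D 0 a v
  D (suc j) a (x ∷ v) = D j a v +ᶠ a *ᶠ D (suc j) a v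

  D-beyond-degree : ∀ {n} (v : Vec Carrier n) {j} a → n ≤ j → D j a v ≈ 0#
  D-beyond-degree []      a _         = ≈-refl
  D-beyond-degree (x ∷ v) a (s≤s n≤j) = begin
    D _ a v +ᶠ a *ᶠ D _ a v  ≈⟨ +-cong (D-beyond-degree v a n≤j) (*-congˡ (D-beyond-degree v a (ℕ.m≤n⇒m≤1+n n≤j))) ⟩
    0# +ᶠ a *ᶠ 0#            ≈⟨ solve 1 (λ a → con 0 :+ a :* con 0 := con 0) ≈-refl a ⟩
    0#                       ∎

  D-leading : ∀ {n} x (v : Vec Carrier (suc n)) a → D (suc n) a (x ∷ v) ≈ D n a v
  D-leading x v a = trans (+-congˡ (trans (*-congˡ (D-beyond-degree v a ℕ.≤-refl)) (zeroʳ a))) (+-identityʳ _)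

  D-+ : ∀ {n} j a (v w : Vec Carrier n) → D j a (zipWith _+ᶠ_ v w) ≈ D j a v +ᶠ D j a w
  D-+ j       a []      []      = sym (+-identityʳ 0#)
  D-+ zero    a (x ∷ v) (y ∷ w) = trans (+-congˡ (*-congˡ (D-+ 0 a v w)))
    (solve 5 (λ x y a s t → (x :+ y) :+ a :* (s :+ t) := (x :+ a :* s) :+ (y :+ a :* t)) ≈-refl x y a _ _)
  D-+ (suc j) a (x ∷ v) (y ∷ w) = trans (+-cong (D-+ j a v w) (*-congˡ (D-+ (suc j) a v w)))
    (solve 5 (λ x y a s t → (x :+ y) :+ a :* (s :+ t) := (x :+ a :* s) :+ (y :+ a :* t)) ≈-refl _ _ a _ _)

  D-zeros : ∀ j a n → D j a (replicate n 0#) ≈ 0#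
  D-zeros j       a zero    = ≈-refl
  D-zeros zero    a (suc n) = trans (+-congˡ (*-congˡ (D-zeros 0 a n))) (trans (+-identityˡ _) (zeroʳ a))
  D-zeros (suc j) a (suc n) = trans (+-cong (D-zeros j a n) (*-congˡ (D-zeros (suc j) a n)))
    (trans (+-identityˡ _) (zeroʳ a))

  -- (v(X) - v(b)) / (X - b)
  quotient : ∀ {n} → Carrier → Vec Carrier (suc n) → Vec Carrier n
  quotient b (x ∷ [])        = []
  quotient b (x ∷ v@(_ ∷ _)) = D 0 b v ∷ quotient b v

  -- The difference a - b enters as a variable `u` with `u + b ≈ a`, because the solver works in
  -- commutative semirings, without subtraction. `K-difference` uses the same device.
  D-zero-quotient : ∀ {n} (v : Vec Carrier (suc n)) {u a b} → u +ᶠ b ≈ a →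
    D 0 a v ≈ u *ᶠ D 0 a (quotient b v) +ᶠ D 0 b v
  D-zero-quotient (x ∷ []) {u} {a} {b} _ =
    solve 4 (λ x a u b → x :+ a :* con 0 := u :* con 0 :+ (x :+ b :* con 0)) ≈-refl x a u b
  D-zero-quotient (x ∷ v@(_ ∷ _)) {u} {a} {b} u+b≈a = begin
    x +ᶠ a *ᶠ D 0 a v                ≈⟨ +-congˡ (*-congˡ (D-zero-quotient v u+b≈a)) ⟩
    x +ᶠ a *ᶠ (u *ᶠ s +ᶠ t)          ≈⟨ solve 5 (λ x a u s t → x :+ a :* (u :* s :+ t) := x :+ (a :* u :* s :+ a :* t)) ≈-refl x a u s t ⟩
    x +ᶠ (a *ᶠ u *ᶠ s +ᶠ a *ᶠ t)     ≈⟨ +-congˡ (+-congˡ (*-congʳ u+b≈a)) ⟨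
    x +ᶠ (a *ᶠ u *ᶠ s +ᶠ (u +ᶠ b) *ᶠ t)
      ≈⟨ solve 6 (λ x a u b s t → x :+ (a :* u :* s :+ (u :+ b) :* t) := u :* (t :+ a :* s) :+ (x :+ b :* t)) ≈-refl x a u b s t ⟩
    u *ᶠ (t +ᶠ a *ᶠ s) +ᶠ (x +ᶠ b *ᶠ t) ∎
    where
    s = D 0 a (quotient b v)
    t = D 0 b v

  -- The Leibniz rule for a product with X - b, whose Hasse derivatives at `a` are `u`, 1, 0, 0 and
  -- so on; only two terms survive.
  D-suc-quotient : ∀ {n} (v : Vec Carrier (suc n)) {u a b} → u +ᶠ b ≈ a → ∀ j →
    D (suc j) a v ≈ u *ᶠ D (suc j) a (quotient b v) +ᶠ D j a (quotient b v)
  D-suc-quotient (x ∷ []) {u} {a} {b} _ j =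
    solve 2 (λ a u → con 0 :+ a :* con 0 := u :* con 0 :+ con 0) ≈-refl a u
  D-suc-quotient (x ∷ v@(_ ∷ _)) {u} {a} {b} u+b≈a zero =
    trans (+-cong (D-zero-quotient v u+b≈a) (*-congˡ (D-suc-quotient v u+b≈a 0)))
      (solve 5 (λ a u r s t → (u :* s :+ t) :+ a :* (u :* r :+ s) := u :* (s :+ a :* r) :+ (t :+ a :* s))
        ≈-refl a u _ _ _)
  D-suc-quotient (x ∷ v@(_ ∷ _)) {u} {a} {b} u+b≈a (suc j) =
    trans (+-cong (D-suc-quotient v u+b≈a j) (*-congˡ (D-suc-quotient v u+b≈a (suc j))))
      (solve 5 (λ a u r s t → (u :* s :+ t) :+ a :* (u :* r :+ s) := u :* (s :+ a :* r) :+ (t :+ a :* s))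
        ≈-refl a u _ _ _)

  VanishesTo : ∀ {n} → Vec Carrier n → Carrier × ℕ → Set ℓ
  VanishesTo v (a , k) = ∀ j → j < k → D j a v ≈ 0#

  a-b≉0 : ∀ {a b} → ¬ (b ≈ a) → ¬ (a -ᶠ b ≈ 0#)
  a-b≉0 {a} {b} b≉a a-b≈0 = b≉a (sym (x-y≈0⇒x≈y a b a-b≈0))

  -- Induction on the order: once the previous derivative of the quotient vanishes, the Leibniz
  -- identity leaves a - b times the next one, and a - b can be cancelled.
  quotient-vanishes-elsewhere : ∀ {n} (v : Vec Carrier (suc n)) {a b k} → ¬ (b ≈ a) → D 0 b v ≈ 0# →
    VanishesTo v (a , k) → VanishesTo (quotient b v) (a , k)
  quotient-vanishes-elsewhere v {a} {b} b≉a vb≈0 van zero 0<k = x*y≈0⇒y≈0 (a-b≉0 b≉a) (begin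
    (a -ᶠ b) *ᶠ D 0 a (quotient b v)              ≈⟨ +-identityʳ _ ⟨
    (a -ᶠ b) *ᶠ D 0 a (quotient b v) +ᶠ 0#        ≈⟨ +-congˡ vb≈0 ⟨
    (a -ᶠ b) *ᶠ D 0 a (quotient b v) +ᶠ D 0 b v   ≈⟨ D-zero-quotient v (x-y+y≈x a b) ⟨
    D 0 a v                                       ≈⟨ van 0 0<k ⟩
    0#                                            ∎)
  quotient-vanishes-elsewhere v {a} {b} b≉a vb≈0 van (suc j) j<k = x*y≈0⇒y≈0 (a-b≉0 b≉a) (begin
    (a -ᶠ b) *ᶠ D (suc j) a (quotient b v)                           ≈⟨ +-identityʳ _ ⟨
    (a -ᶠ b) *ᶠ D (suc j) a (quotient b v) +ᶠ 0#
      ≈⟨ +-congˡ (quotient-vanishes-elsewhere v b≉a vb≈0 van j (ℕ.<-trans (ℕ.n<1+n j) j<k)) ⟨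
    (a -ᶠ b) *ᶠ D (suc j) a (quotient b v) +ᶠ D j a (quotient b v)   ≈⟨ D-suc-quotient v (x-y+y≈x a b) j ⟨
    D (suc j) a v                                                    ≈⟨ van (suc j) j<k ⟩
    0#                                                               ∎)

  quotient-vanishes-here : ∀ {n} (v : Vec Carrier (suc n)) {b k} →
    VanishesTo v (b , suc k) → VanishesTo (quotient b v) (b , k)
  quotient-vanishes-here v {b} van j j<k = begin
    D j b (quotient b v)                                          ≈⟨ +-identityˡ _ ⟨
    0# +ᶠ D j b (quotient b v)                                    ≈⟨ +-congʳ (zeroˡ _) ⟨
    0# *ᶠ D (suc j) b (quotient b v) +ᶠ D j b (quotient b v)      ≈⟨ D-suc-quotient v (+-identityˡ b) j ⟨
    D (suc j) b v                                                 ≈⟨ van (suc j) (s<s j<k) ⟩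
    0#                                                            ∎

  -- For a vector of length `suc n`, `D n a v` is the coefficient of X^n, whatever `a` is. Each step
  -- divides by X - b for the first root `b`, which lowers the degree and the order at `b` by one
  -- and keeps the other orders.
  too-many-roots : ∀ {n} (v : Vec Carrier (suc n)) (roots : List (Carrier × ℕ)) →
    AllPairs (λ x y → ¬ (proj₁ x ≈ proj₁ y)) roots → All (VanishesTo v) roots →
    n < sum (map proj₂ roots) → ∀ a → D n a v ≈ 0#
  too-many-roots v ((b , zero) ∷ roots) (_ ∷ distinct) (_ ∷ van) n< a = too-many-roots v roots distinct van n< a
  too-many-roots {zero} (x ∷ []) ((b , suc k) ∷ roots) _ (van ∷ _) _ a = begin
    x +ᶠ a *ᶠ 0#  ≈⟨ +-congˡ (trans (zeroʳ a) (sym (zeroʳ b))) ⟩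
    x +ᶠ b *ᶠ 0#  ≈⟨ van 0 ℕ.0<1+n ⟩
    0#            ∎
  too-many-roots {suc n} v ((b , suc k) ∷ roots) (b≉ ∷ distinct) (van ∷ vans) n< a = begin
    D (suc n) a v            ≈⟨ D-suc-quotient v (x-y+y≈x a b) n ⟩
    (a -ᶠ b) *ᶠ D (suc n) a w +ᶠ D n a w
      ≈⟨ +-cong (*-congˡ (D-beyond-degree w a ℕ.≤-refl)) (too-many-roots w ((b , k) ∷ roots) (b≉ ∷ distinct)
           (quotient-vanishes-here v van ∷ All.zipWith (λ (b≉a , van′) →
             quotient-vanishes-elsewhere v b≉a (van 0 ℕ.0<1+n) van′) (b≉ , vans))
           (s≤s⁻¹ n<) a) ⟩
    (a -ᶠ b) *ᶠ 0# +ᶠ 0#     ≈⟨ trans (+-identityʳ _) (zeroʳ _) ⟩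
    0#                       ∎
    where w = quotient b v

  roots≤degree : ∀ {n} (v : Vec Carrier (suc n)) (xs : List Carrier) →
    AllPairs (λ x y → ¬ (x ≈ y)) xs → All (λ x → D 0 x v ≈ 0#) xs →
    (∀ a → ¬ (D n a v ≈ 0#)) → length xs ≤ n
  roots≤degree {n} v xs distinct zeros lead≉0 = ℕ.≮⇒≥ λ n<len → lead≉0 0# (too-many-roots v (map (_, 1) xs)
    (AllPairs.map⁺ distinct)
    (All.map⁺ (All.map (λ { eq zero _ → eq ; eq (suc j) (s≤s ()) }) zeros))
    (subst (n <_) (≡.sym (sum-ones xs)) n<len) 0#)
    where
    sum-ones : ∀ (ys : List Carrier) → sum (map proj₂ (map (_, 1) ys)) ≡ length ys
    sum-ones []       = ≡.refl
    sum-ones (_ ∷ ys) = cong suc (sum-ones ys)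

  -- e + (X + u) v
  mulLinear : ∀ {n} → Carrier → Carrier → Vec Carrier n → Vec Carrier (suc n)
  mulLinear u e []      = e ∷ []
  mulLinear u e (x ∷ v) = (e +ᶠ u *ᶠ x) ∷ mulLinear u x v

  D-zero-mulLinear : ∀ {n} u e (v : Vec Carrier n) a →
    D 0 a (mulLinear u e v) ≈ e +ᶠ (a +ᶠ u) *ᶠ D 0 a v
  D-zero-mulLinear u e []      a = solve 3 (λ u e a → e :+ a :* con 0 := e :+ (a :+ u) :* con 0) ≈-refl u e a
  D-zero-mulLinear u e (x ∷ v) a = trans (+-congˡ (*-congˡ (D-zero-mulLinear u x v a)))
    (solve 5 (λ u e x a s → (e :+ u :* x) :+ a :* (x :+ (a :+ u) :* s) := e :+ (a :+ u) :* (x :+ a :* s))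
      ≈-refl u e x a _)

  D-suc-mulLinear : ∀ {n} u e (v : Vec Carrier n) a j →
    D (suc j) a (mulLinear u e v) ≈ (a +ᶠ u) *ᶠ D (suc j) a v +ᶠ D j a v
  D-suc-mulLinear u e []      a j = solve 2 (λ u a → con 0 :+ a :* con 0 := (a :+ u) :* con 0 :+ con 0) ≈-refl u a
  D-suc-mulLinear u e (x ∷ v) a zero =
    trans (+-cong (D-zero-mulLinear u x v a) (*-congˡ (D-suc-mulLinear u x v a 0)))
      (solve 5 (λ u x a s t → (x :+ (a :+ u) :* s) :+ a :* ((a :+ u) :* t :+ s)
          := (a :+ u) :* (s :+ a :* t) :+ (x :+ a :* s)) ≈-refl u x a _ _)
  D-suc-mulLinear u e (x ∷ v) a (suc j) =
    trans (+-cong (D-suc-mulLinear u x v a j) (*-congˡ (D-suc-mulLinear u x v a (suc j))))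
      (solve 5 (λ u a r s t → ((a :+ u) :* s :+ r) :+ a :* ((a :+ u) :* t :+ s)
          := (a :+ u) :* (s :+ a :* t) :+ (r :+ a :* s)) ≈-refl u a _ _ _)

  -- K ys n is the complete homogeneous symmetric polynomial of degree
  -- n - length ys in ys, i.e. the divided difference of x ↦ x ^ (n - 1) at ys.
  K : List Carrier → ℕ → Carrier
  K []       zero    = 1#
  K []       (suc n) = 0#
  K (y ∷ ys) zero    = 0#
  K (y ∷ ys) (suc n) = y *ᶠ K (y ∷ ys) n +ᶠ K ys n

  K-below : ∀ ys {n} → n < length ys → K ys n ≈ 0#
  K-below (y ∷ ys) {zero}  _        = ≈-refl
  K-below (y ∷ ys) {suc n} (s≤s lt) = begin
    y *ᶠ K (y ∷ ys) n +ᶠ K ys n  ≈⟨ +-cong (*-congˡ (K-below (y ∷ ys) (ℕ.m≤n⇒m≤1+n lt))) (K-below ys lt) ⟩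
    y *ᶠ 0# +ᶠ 0#                ≈⟨ trans (+-identityʳ _) (zeroʳ y) ⟩
    0#                           ∎

  K-diagonal : ∀ ys → K ys (length ys) ≈ 1#
  K-diagonal []       = ≈-refl
  K-diagonal (y ∷ ys) = begin
    y *ᶠ K (y ∷ ys) (length ys) +ᶠ K ys (length ys)
      ≈⟨ +-cong (*-congˡ (K-below (y ∷ ys) (ℕ.n<1+n _))) (K-diagonal ys) ⟩
    y *ᶠ 0# +ᶠ 1#  ≈⟨ trans (+-congʳ (zeroʳ y)) (+-identityˡ 1#) ⟩
    1#             ∎

  K-singleton : ∀ y n → K (y ∷ []) (suc n) ≈ y ^ᶠ n
  K-singleton y zero    = trans (+-congʳ (zeroʳ y)) (+-identityˡ 1#)
  K-singleton y (suc n) = trans (+-identityʳ _) (*-congˡ (K-singleton y n))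

  -- The recursion f[y, ys] - f[z, ys] = (y - z) f[y, z, ys] of divided differences, with `u` for y
  -- - z.
  K-difference : ∀ {u y z} ys → u +ᶠ z ≈ y → ∀ n →
    u *ᶠ K (y ∷ z ∷ ys) n +ᶠ K (z ∷ ys) n ≈ K (y ∷ ys) n
  K-difference {u} ys _ zero = trans (+-identityʳ _) (zeroʳ u)
  K-difference {u} {y} {z} ys u+z≈y (suc n) = begin
    u *ᶠ (y *ᶠ r +ᶠ s) +ᶠ (z *ᶠ s +ᶠ t)
      ≈⟨ solve 6 (λ u y z r s t → u :* (y :* r :+ s) :+ (z :* s :+ t) := (y :* u :* r :+ (u :+ z) :* s) :+ t)
           ≈-refl u y z r s t ⟩
    (y *ᶠ u *ᶠ r +ᶠ (u +ᶠ z) *ᶠ s) +ᶠ t  ≈⟨ +-congʳ (+-congˡ (*-congʳ u+z≈y)) ⟩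
    (y *ᶠ u *ᶠ r +ᶠ y *ᶠ s) +ᶠ t
      ≈⟨ solve 5 (λ u y r s t → (y :* u :* r :+ y :* s) :+ t := y :* (u :* r :+ s) :+ t) ≈-refl u y r s t ⟩
    y *ᶠ (u *ᶠ r +ᶠ s) +ᶠ t              ≈⟨ +-congʳ (*-congˡ (K-difference ys u+z≈y n)) ⟩
    y *ᶠ K (y ∷ ys) n +ᶠ t               ∎
    where
    r = K (y ∷ z ∷ ys) n
    s = K (z ∷ ys) n
    t = K ys n

  -- At distinct points a divided difference is determined by the values there, and the powers with
  -- exponents `h + (e + n)` and `e + n` agree at every point. The induction removes points by
  -- `K-difference` and cancels y - z.
  K-periodic : ∀ h e y ys → AllPairs (λ y z → ¬ (y ≈ z)) (y ∷ ys) →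
    All (λ y → y ^ᶠ (h + e) ≈ y ^ᶠ e) (y ∷ ys) → ∀ n →
    K (y ∷ ys) (suc (h + (e + n))) ≈ K (y ∷ ys) (suc (e + n))
  K-periodic h e y [] _ (per ∷ []) n = begin
    K (y ∷ []) (suc (h + (e + n)))  ≈⟨ K-singleton y (h + (e + n)) ⟩
    y ^ᶠ (h + (e + n))              ≡⟨ cong (y ^ᶠ_) (ℕ.+-assoc h e n) ⟨
    y ^ᶠ (h + e + n)                ≈⟨ Exp.^-homo-* commutativeSemiring y (h + e) n ⟩
    y ^ᶠ (h + e) *ᶠ y ^ᶠ n          ≈⟨ *-congʳ per ⟩
    y ^ᶠ e *ᶠ y ^ᶠ n                ≈⟨ Exp.^-homo-* commutativeSemiring y e n ⟨
    y ^ᶠ (e + n)                    ≈⟨ K-singleton y (e + n) ⟨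
    K (y ∷ []) (suc (e + n))        ∎
  K-periodic h e y (z ∷ ys) ((y≉z ∷ y≉) ∷ z≉ ∷ distinct) (per-y ∷ per-z ∷ pers) n =
    *-cancelˡ-≉0 (λ y-z≈0 → y≉z (x-y≈0⇒x≈y y z y-z≈0)) (+-cancelʳ _ _ _ (begin
      (y -ᶠ z) *ᶠ K (y ∷ z ∷ ys) (suc (h + (e + n))) +ᶠ K (z ∷ ys) (suc (h + (e + n)))
        ≈⟨ K-difference ys (x-y+y≈x y z) (suc (h + (e + n))) ⟩
      K (y ∷ ys) (suc (h + (e + n)))  ≈⟨ K-periodic h e y ys (y≉ ∷ distinct) (per-y ∷ pers) n ⟩
      K (y ∷ ys) (suc (e + n))        ≈⟨ K-difference ys (x-y+y≈x y z) (suc (e + n)) ⟨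
      (y -ᶠ z) *ᶠ K (y ∷ z ∷ ys) (suc (e + n)) +ᶠ K (z ∷ ys) (suc (e + n))
        ≈⟨ +-congˡ (K-periodic h e z ys (z≉ ∷ distinct) (per-z ∷ pers) n) ⟨
      (y -ᶠ z) *ᶠ K (y ∷ z ∷ ys) (suc (e + n)) +ᶠ K (z ∷ ys) (suc (h + (e + n))) ∎))

  ι : ℕ → Carrier
  ι n = n ×ᶠ 1#

  ι-C0 : ∀ n → ι (n C 0) ≈ 1#
  ι-C0 n = trans (reflexive (cong ι (nC0≡1 n))) (+-identityʳ 1#)

  ι-C-beyond : ∀ {n k} x → n < k → ι (n C k) *ᶠ x ≈ 0#
  ι-C-beyond x n<k = trans (*-congʳ (reflexive (cong ι (k>n⇒nCk≡0 n<k)))) (zeroˡ x)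

  -- The complete homogeneous symmetric polynomial of degree k in the X - b, b ∈ bs.
  H : ∀ k → List Carrier → Vec Carrier (suc k)
  H zero    bs       = 1# ∷ []
  H (suc k) []       = replicate _ 0#
  H (suc k) (b ∷ bs) = zipWith _+ᶠ_ (H (suc k) bs) (mulLinear (- b) 0# (H k (b ∷ bs)))

  -- The Leibniz rule for H_{k+1}(b, bs) = H_{k+1}(bs) + (X - b) H_k(b, bs). Both hypotheses have
  -- the same upper index `N`, so Pascal's rule adds the binomial coefficients while the recursion
  -- of `K` joins the other factors.
  D-H-step : ∀ k b bs a → let N = k + length bs; y = a -ᶠ b; ys = map (a -ᶠ_) bs in
    (∀ j → D j a (H (suc k) bs) ≈ ι (N C j) *ᶠ K ys (suc N ∸ j)) →
    (∀ j → D j a (H k (b ∷ bs)) ≈ ι (N C j) *ᶠ K (y ∷ ys) (suc N ∸ j)) →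
    ∀ j → D j a (H (suc k) (b ∷ bs)) ≈ ι (suc N C j) *ᶠ K (y ∷ ys) (suc (suc N) ∸ j)
  D-H-step k b bs a ih′ ih j = trans (D-+ j a (H (suc k) bs) _) (step j)
    where
    N = k + length bs
    y = a -ᶠ b
    ys = map (a -ᶠ_) bs

    step : ∀ j → D j a (H (suc k) bs) +ᶠ D j a (mulLinear (- b) 0# (H k (b ∷ bs)))
      ≈ ι (suc N C j) *ᶠ K (y ∷ ys) (suc (suc N) ∸ j)
    step zero = begin
      D 0 a (H (suc k) bs) +ᶠ D 0 a (mulLinear (- b) 0# (H k (b ∷ bs)))
        ≈⟨ +-cong (ih′ 0) (trans (D-zero-mulLinear (- b) 0# (H k (b ∷ bs)) a) (+-congˡ (*-congˡ (ih 0)))) ⟩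
      ι (N C 0) *ᶠ t +ᶠ (0# +ᶠ y *ᶠ (ι (N C 0) *ᶠ r))
        ≈⟨ +-cong (*-congʳ (ι-C0 N)) (+-congˡ (*-congˡ (*-congʳ (ι-C0 N)))) ⟩
      1# *ᶠ t +ᶠ (0# +ᶠ y *ᶠ (1# *ᶠ r))
        ≈⟨ solve 3 (λ y r t → con 1 :* t :+ (con 0 :+ y :* (con 1 :* r)) := con 1 :* (y :* r :+ t)) ≈-refl y r t ⟩
      1# *ᶠ (y *ᶠ r +ᶠ t)                ≈⟨ *-congʳ (ι-C0 (suc N)) ⟨
      ι (suc N C 0) *ᶠ (y *ᶠ r +ᶠ t)     ∎
      where
      r = K (y ∷ ys) (suc N)
      t = K ys (suc N)
    -- Unfolding `K` at `suc N ∸ j` needs an untruncated difference; for `j` above `N` every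
    -- binomial coefficient involved is zero.
    step (suc j) with j ℕ.≤? N
    ... | yes j≤N = begin
      D (suc j) a (H (suc k) bs) +ᶠ D (suc j) a (mulLinear (- b) 0# (H k (b ∷ bs)))
        ≈⟨ +-cong (ih′ (suc j))
             (trans (D-suc-mulLinear (- b) 0# (H k (b ∷ bs)) a j) (+-cong (*-congˡ (ih (suc j))) (ih j))) ⟩
      β *ᶠ t +ᶠ (y *ᶠ (β *ᶠ r) +ᶠ α *ᶠ K (y ∷ ys) (suc N ∸ j))
        ≡⟨ cong (λ n → β *ᶠ t +ᶠ (y *ᶠ (β *ᶠ r) +ᶠ α *ᶠ K (y ∷ ys) n)) (ℕ.+-∸-assoc 1 j≤N) ⟩
      β *ᶠ t +ᶠ (y *ᶠ (β *ᶠ r) +ᶠ α *ᶠ (y *ᶠ r +ᶠ t))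
        ≈⟨ solve 5 (λ α β y r t → β :* t :+ (y :* (β :* r) :+ α :* (y :* r :+ t))
             := (α :+ β) :* (y :* r :+ t)) ≈-refl α β y r t ⟩
      (α +ᶠ β) *ᶠ (y *ᶠ r +ᶠ t)          ≈⟨ *-congʳ (×-homo-+ 1# (N C j) (N C suc j)) ⟨
      ι ((N C j) + (N C suc j)) *ᶠ (y *ᶠ r +ᶠ t)
        ≡⟨ ≡.cong₂ (λ i n → ι i *ᶠ K (y ∷ ys) n) (nCk+nC[k+1]≡[n+1]C[k+1] N j) (≡.sym (ℕ.+-∸-assoc 1 j≤N)) ⟩
      ι (suc N C suc j) *ᶠ K (y ∷ ys) (suc N ∸ j) ∎
      where
      α = ι (N C j)
      β = ι (N C suc j)
      r = K (y ∷ ys) (N ∸ j)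
      t = K ys (N ∸ j)
    ... | no j≰N = begin
      D (suc j) a (H (suc k) bs) +ᶠ D (suc j) a (mulLinear (- b) 0# (H k (b ∷ bs)))
        ≈⟨ +-cong (ih′ (suc j))
             (trans (D-suc-mulLinear (- b) 0# (H k (b ∷ bs)) a j) (+-cong (*-congˡ (ih (suc j))) (ih j))) ⟩
      _ +ᶠ (y *ᶠ _ +ᶠ _)
        ≈⟨ +-cong (ι-C-beyond _ N<1+j) (+-cong (*-congˡ (ι-C-beyond _ N<1+j)) (ι-C-beyond _ (ℕ.≰⇒> j≰N))) ⟩
      0# +ᶠ (y *ᶠ 0# +ᶠ 0#)   ≈⟨ solve 1 (λ y → con 0 :+ (y :* con 0 :+ con 0) := con 0) ≈-refl y ⟩
      0#                      ≈⟨ ι-C-beyond _ (s≤s (ℕ.≰⇒> j≰N)) ⟨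
      ι (suc N C suc j) *ᶠ K (y ∷ ys) (suc N ∸ j) ∎
      where N<1+j = ℕ.m≤n⇒m≤1+n (ℕ.≰⇒> j≰N)

  -- With y = a - b, shifting X by ε turns the generating function ∏ 1 / (1 - t y) into ∏ 1 / (1 - t
  -- (y + ε)), whose coefficient at t^k ε^j is the right-hand side. `pred` truncates only when `k`
  -- and `m` are both zero, where the polynomial is 1.
  D-H : ∀ k bs j a → let m = length bs in
    D j a (H k bs) ≈ ι (pred (k + m) C j) *ᶠ K (map (a -ᶠ_) bs) (k + m ∸ j)
  D-H zero bs zero a = begin
    1# +ᶠ a *ᶠ 0#                      ≈⟨ trans (+-congˡ (zeroʳ a)) (+-identityʳ 1#) ⟩
    1#                                 ≈⟨ *-identityʳ 1# ⟨
    1# *ᶠ 1#                           ≈⟨ *-cong (ι-C0 (pred (length bs))) (K-diagonal ys) ⟨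
    ι (pred (length bs) C 0) *ᶠ K ys (length ys)  ≡⟨ cong (λ m → ι (pred (length bs) C 0) *ᶠ K ys m) (length-map (a -ᶠ_) bs) ⟩
    ι (pred (length bs) C 0) *ᶠ K ys (length bs)  ∎
    where ys = map (a -ᶠ_) bs
  D-H zero [] (suc j) a = begin
    0# +ᶠ a *ᶠ 0#           ≈⟨ trans (+-identityˡ _) (zeroʳ a) ⟩
    0#                      ≈⟨ ι-C-beyond _ (ℕ.0<1+n {j}) ⟨
    ι (0 C suc j) *ᶠ 1#     ∎
  D-H zero (b ∷ bs) (suc j) a = begin
    0# +ᶠ a *ᶠ 0#           ≈⟨ trans (+-identityˡ _) (zeroʳ a) ⟩
    0#                      ≈⟨ zeroʳ _ ⟨
    ι (length bs C suc j) *ᶠ 0#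
      ≈⟨ *-congˡ (K-below ys (s≤s (ℕ.≤-trans (ℕ.m∸n≤m _ j) (ℕ.≤-reflexive (≡.sym (length-map (a -ᶠ_) bs)))))) ⟨
    ι (length bs C suc j) *ᶠ K ys (length bs ∸ j)  ∎
    where ys = map (a -ᶠ_) (b ∷ bs)
  D-H (suc k) [] j a with j ℕ.≤? k + 0
  ... | yes j≤k = begin
    D j a (replicate (suc (suc k)) 0#)          ≈⟨ D-zeros j a (suc (suc k)) ⟩
    0#                                          ≈⟨ zeroʳ _ ⟨
    ι ((k + 0) C j) *ᶠ K [] (suc (k + 0 ∸ j))   ≡⟨ cong (λ m → ι ((k + 0) C j) *ᶠ K [] m) (ℕ.+-∸-assoc 1 j≤k) ⟨
    ι ((k + 0) C j) *ᶠ K [] (suc (k + 0) ∸ j)   ∎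
  ... | no j≰k = trans (D-zeros j a (suc (suc k))) (sym (ι-C-beyond _ (ℕ.≰⇒> j≰k)))
  D-H (suc k) (b ∷ bs) j a = trans
    (D-H-step k b bs a (λ i → D-H (suc k) bs i a)
      (λ i → trans (D-H k (b ∷ bs) i a)
        (reflexive (cong (λ n → ι (pred n C i) *ᶠ K (map (a -ᶠ_) (b ∷ bs)) (n ∸ i)) (ℕ.+-suc k (length bs))))) j)
    (reflexive (cong (λ n → ι (n C j) *ᶠ K (map (a -ᶠ_) (b ∷ bs)) (suc n ∸ j)) (≡.sym (ℕ.+-suc k (length bs)))))

-- Stepanov's method: the auxiliary polynomial and its root count.

module Stepanov {q : ℕ} {c ℓ : Level} (F : FiniteField q c ℓ) where
  open Polynomials F
  open FiniteField F hiding (zero) renaming (_+_ to infixl 6 _+ᶠ_; _*_ to infixl 7 _*ᶠ_; _-_ to infixl 6 _-ᶠ_)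
  open Exp commutativeSemiring using (^-congˡ; ^-congʳ; ^-homo-*) renaming (_^_ to infixr 8 _^ᶠ_)
  open Group +-group using (⁻¹-injective) renaming (∙-cancelˡ to +-cancelˡ)
  open Reasoning setoidF

  addConstant : ∀ {n} → Carrier → Vec Carrier (suc n) → Vec Carrier (suc n)
  addConstant e (x ∷ v) = (e +ᶠ x) ∷ v

  D-zero-addConstant : ∀ {n} e (v : Vec Carrier (suc n)) a → D 0 a (addConstant e v) ≈ e +ᶠ D 0 a v
  D-zero-addConstant e (x ∷ v) a = +-assoc e x _

  D-suc-addConstant : ∀ {n} e (v : Vec Carrier (suc n)) j a → D (suc j) a (addConstant e v) ≡ D (suc j) a v
  D-suc-addConstant e (x ∷ v) j a = ≡.refl

  -- The differences a - b satisfy y ^ h ≈ 1# if a ∉ bs (e = 0), and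
  -- only y ^ (h + 1) ≈ y if a ∈ bs (e = 1), which costs one order of vanishing.
  auxiliary-vanishes : ∀ h e b bs a μ → μ + e ≡ suc (length bs) →
    AllPairs (λ x y → ¬ (x ≈ y)) (b ∷ bs) →
    All (λ x → (a -ᶠ x) ^ᶠ (h + e) ≈ (a -ᶠ x) ^ᶠ e) (b ∷ bs) →
    VanishesTo (addConstant (- 1#) (H h (b ∷ bs))) (a , μ)
  auxiliary-vanishes h e b bs a μ μ+e≡1+m distinct per j j<μ
    -- Here `n` is `μ - 1 - j`, so `j + (e + n)` is `m`. Once `h` is removed from the exponent, `K`
    -- has index `suc m - j`: for `j` zero it is on the diagonal and its value 1 cancels the
    -- constant, for positive `j` it is below the diagonal and vanishes.
    with n , ≡.refl ← ℕ.m≤n⇒∃[o]m+o≡n j<μ = vanishes j (≡.trans (order j e n) (ℕ.suc-injective μ+e≡1+m))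
    where
    y = a -ᶠ b
    ys = map (a -ᶠ_) bs
    m = length bs

    order : ∀ j e n → j + (e + n) ≡ j + n + e
    order = solve-∀

    index : ∀ h j r → h + suc (j + r) ≡ j + suc (h + r)
    index = solve-∀

    K-value : ∀ j → j + (e + n) ≡ m → K (y ∷ ys) (h + suc m ∸ j) ≈ K (y ∷ ys) (suc (e + n))
    K-value j j+e+n≡m = begin
      K (y ∷ ys) (h + suc m ∸ j)              ≡⟨ cong (λ m → K (y ∷ ys) (h + suc m ∸ j)) j+e+n≡m ⟨
      K (y ∷ ys) (h + suc (j + (e + n)) ∸ j)  ≡⟨ cong (λ i → K (y ∷ ys) (i ∸ j)) (index h j (e + n)) ⟩
      K (y ∷ ys) (j + suc (h + (e + n)) ∸ j)  ≡⟨ cong (K (y ∷ ys)) (ℕ.m+n∸m≡n j _) ⟩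
      K (y ∷ ys) (suc (h + (e + n)))
        ≈⟨ K-periodic h e y ys
             (AllPairs.map⁺ (AllPairs.map (λ x≉y eq → x≉y (⁻¹-injective (+-cancelˡ a _ _ eq))) distinct))
             (All.map⁺ per) n ⟩
      K (y ∷ ys) (suc (e + n))                ∎

    vanishes : ∀ j → j + (e + n) ≡ m → D j a (addConstant (- 1#) (H h (b ∷ bs))) ≈ 0#
    vanishes zero e+n≡m = begin
      D 0 a (addConstant (- 1#) (H h (b ∷ bs)))  ≈⟨ D-zero-addConstant (- 1#) (H h (b ∷ bs)) a ⟩
      - 1# +ᶠ D 0 a (H h (b ∷ bs))               ≈⟨ +-congˡ (D-H h (b ∷ bs) 0 a) ⟩
      - 1# +ᶠ ι (pred (h + suc m) C 0) *ᶠ K (y ∷ ys) (h + suc m)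
        ≈⟨ +-congˡ (*-cong (ι-C0 (pred (h + suc m))) (K-value 0 e+n≡m)) ⟩
      - 1# +ᶠ 1# *ᶠ K (y ∷ ys) (suc (e + n))
        ≡⟨ cong (λ i → - 1# +ᶠ 1# *ᶠ K (y ∷ ys) (suc i)) (≡.trans e+n≡m (≡.sym (length-map (a -ᶠ_) bs))) ⟩
      - 1# +ᶠ 1# *ᶠ K (y ∷ ys) (length (y ∷ ys))
        ≈⟨ +-congˡ (trans (*-identityˡ _) (K-diagonal (y ∷ ys))) ⟩
      - 1# +ᶠ 1#                                 ≈⟨ -‿inverseˡ 1# ⟩
      0#                                         ∎
    vanishes (suc j) j+e+n≡m = begin
      D (suc j) a (addConstant (- 1#) (H h (b ∷ bs)))  ≡⟨ D-suc-addConstant (- 1#) (H h (b ∷ bs)) j a ⟩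
      D (suc j) a (H h (b ∷ bs))                       ≈⟨ D-H h (b ∷ bs) (suc j) a ⟩
      ι (pred (h + suc m) C suc j) *ᶠ K (y ∷ ys) (h + suc m ∸ suc j)
        ≈⟨ *-congˡ (trans (K-value (suc j) j+e+n≡m) (K-below (y ∷ ys) (s<s
             (≡.subst (e + n <_) (≡.trans j+e+n≡m (≡.sym (length-map (a -ᶠ_) bs))) (s≤s (ℕ.m≤n+m (e + n) j)))))) ⟩
      ι (pred (h + suc m) C suc j) *ᶠ 0#               ≈⟨ zeroʳ _ ⟩
      0#                                               ∎

  -- The first `suc k` members serve as B. Orders `k` on B and `suc k` at the other `l` members add
  -- up to `suc k * (k + l)`; more than `h` would kill the leading coefficient `(h + k) C h`.
  stepanov : ∀ h k l (A : Fin (suc k + l) → Carrier) → 0 < h →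
    (∀ i j → i ≢ j → ¬ (A i ≈ A j)) → (∀ i j → i ≢ j → (A i -ᶠ A j) ^ᶠ h ≈ 1#) →
    ¬ (ι ((h + k) C h) ≈ 0#) → suc k * (k + l) ≤ h
  -- The leading coefficient is `D-H` at `j = h`, where `K` is on the diagonal. Since `h` is a
  -- successor, the added constant does not touch it.
  stepanov h@(suc h′) k l A _ A-injective powers lead≉0 = ℕ.≮⇒≥ λ h< → lead≉0 (begin
    ι ((h + k) C h)                   ≈⟨ *-identityʳ _ ⟨
    ι ((h + k) C h) *ᶠ 1#             ≈⟨ *-congˡ (K-diagonal (map (0# -ᶠ_) bs)) ⟨
    ι ((h + k) C h) *ᶠ K (map (0# -ᶠ_) bs) (length (map (0# -ᶠ_) bs))
      ≡⟨ cong₂ (λ i j → ι (i C h) *ᶠ K (map (0# -ᶠ_) bs) j)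
           (≡.sym (≡.cong pred (≡.trans (cong (h +_) length-bs) (ℕ.+-suc h k))))
           (≡.trans (length-map (0# -ᶠ_) bs) (≡.sym (ℕ.m+n∸m≡n h (length bs)))) ⟩
    ι (pred (h + length bs) C h) *ᶠ K (map (0# -ᶠ_) bs) (h + length bs ∸ h)  ≈⟨ D-H h bs h 0# ⟨
    D h 0# (H h bs)                   ≡⟨ D-suc-addConstant (- 1#) (H h bs) h′ 0# ⟨
    D h 0# (addConstant (- 1#) (H h bs))
      ≈⟨ too-many-roots (addConstant (- 1#) (H h bs)) roots roots-distinct roots-vanish
           (subst (h <_) (≡.sym sum-orders) h<) 0# ⟩
    0#                                ∎)
    where
    low : Fin (suc k) → Carrier
    low i = A (i ↑ˡ l)

    high : Fin l → Carrier
    high i = A (suc k ↑ʳ i)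

    low≢high : ∀ i j → i ↑ˡ l ≢ suc k ↑ʳ j
    low≢high i j eq with () ← ≡.trans (≡.sym (Fin.splitAt-↑ˡ (suc k) i l))
      (≡.trans (cong (splitAt (suc k)) eq) (Fin.splitAt-↑ʳ (suc k) l j))

    bs = tabulate low

    length-bs : length bs ≡ suc k
    length-bs = length-tabulate low

    bs-distinct : AllPairs (λ x y → ¬ (x ≈ y)) bs
    bs-distinct = AllPairs.tabulate⁺ λ i≢j → A-injective _ _ λ eq → i≢j (Fin.↑ˡ-injective l _ _ eq)

    low-roots = tabulate λ i → low i , k
    high-roots = tabulate λ i → high i , suc k
    roots = low-roots ++ high-roots

    roots-distinct : AllPairs (λ x y → ¬ (proj₁ x ≈ proj₁ y)) roots
    roots-distinct = AllPairs.++⁺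
      (AllPairs.tabulate⁺ {f = λ i → low i , k} λ i≢j → A-injective _ _ λ eq → i≢j (Fin.↑ˡ-injective l _ _ eq))
      (AllPairs.tabulate⁺ λ i≢j → A-injective _ _ λ eq → i≢j (Fin.↑ʳ-injective (suc k) _ _ eq))
      (All.tabulate⁺ {f = λ i → low i , k} λ i → All.tabulate⁺ {f = λ j → high j , suc k} λ j →
        A-injective _ _ (low≢high i j))

    low-periodic : ∀ i j → (A i -ᶠ A j) ^ᶠ (h + 1) ≈ (A i -ᶠ A j) ^ᶠ 1
    low-periodic i j with i Fin.≟ j
    -- Both sides are powers of zero with positive exponents, which is why `e` is 1 on B.
    ... | yes ≡.refl = trans (^-congˡ (h + 1) (-‿inverseʳ (A i)))
      (trans (zeroˡ _) (trans (sym (zeroˡ _)) (sym (^-congˡ 1 (-‿inverseʳ (A i))))))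
    ... | no i≢j = trans (^-homo-* _ h 1) (trans (*-congʳ (powers i j i≢j)) (*-identityˡ _))

    high-periodic : ∀ i j → i ≢ j → (A i -ᶠ A j) ^ᶠ (h + 0) ≈ 1#
    high-periodic i j i≢j = trans (^-congʳ _ (ℕ.+-identityʳ h)) (powers i j i≢j)

    roots-vanish : All (VanishesTo (addConstant (- 1#) (H h bs))) roots
    roots-vanish = All.++⁺
      (All.tabulate⁺ λ i → auxiliary-vanishes h 1 _ _ (low i) k
        (≡.trans (ℕ.+-comm k 1) (≡.sym length-bs)) bs-distinct (All.tabulate⁺ {f = low} λ j → low-periodic (i ↑ˡ l) (j ↑ˡ l)))
      (All.tabulate⁺ λ i → auxiliary-vanishes h 0 _ _ (high i) (suc k)
        (≡.trans (ℕ.+-identityʳ (suc k)) (≡.sym length-bs)) bs-distinct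
        (All.tabulate⁺ {f = low} λ j → high-periodic (suc k ↑ʳ i) (j ↑ˡ l) λ eq → low≢high j i (≡.sym eq)))

    sum-constant : ∀ {n} (f : Fin n → Carrier) m → sum (map proj₂ (tabulate λ i → f i , m)) ≡ n * m
    sum-constant {zero}  f m = ≡.refl
    sum-constant {suc n} f m = cong (m +_) (sum-constant (λ i → f (suc i)) m)

    sum-orders : sum (map proj₂ roots) ≡ suc k * (k + l)
    sum-orders = ≡.trans (cong sum (map-++ proj₂ low-roots high-roots))
      (≡.trans (sum-++ (map proj₂ low-roots) (map proj₂ high-roots))
      (≡.trans (cong₂ _+_ (sum-constant low k) (≡.trans (sum-constant high (suc k)) (ℕ.*-comm l (suc k))))
        (≡.sym (ℕ.*-distribˡ-+ (suc k) k l))))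

-- Root bounds for geometric sums.

module Geometric {q : ℕ} {c ℓ : Level} (F : FiniteField q c ℓ) where
  open Polynomials F
  open FiniteField F hiding (zero) renaming (_+_ to infixl 6 _+ᶠ_; _*_ to infixl 7 _*ᶠ_; _-_ to infixl 6 _-ᶠ_)
  open Exp commutativeSemiring using () renaming (_^_ to infixr 8 _^ᶠ_)
  open Group +-group using () renaming (∙-cancelʳ to +-cancelʳ; x∙y⁻¹≈ε⇒x≈y to x-y≈0⇒x≈y)
  open Reasoning setoidF

  -- e + X ^ suc k * v
  shift : ∀ {n} k → Carrier → Vec Carrier (suc n) → Vec Carrier (suc (suc k + n))
  shift zero    e v = e ∷ v
  shift (suc k) e v = e ∷ shift k 0# v

  D-zero-shift : ∀ {n} k e (v : Vec Carrier (suc n)) a → D 0 a (shift k e v) ≈ e +ᶠ a ^ᶠ suc k *ᶠ D 0 a v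
  D-zero-shift zero    e v a = +-congˡ (*-congʳ (sym (*-identityʳ a)))
  D-zero-shift (suc k) e v a = +-congˡ (trans (*-congˡ (trans (D-zero-shift k 0# v a) (+-identityˡ _))) (sym (*-assoc _ _ _)))

  D-leading-shift : ∀ {n} k e (v : Vec Carrier (suc n)) a → D (suc k + n) a (shift k e v) ≈ D n a v
  D-leading-shift zero    e v a = D-leading e v a
  D-leading-shift (suc k) e v a = trans (D-leading e (shift k 0# v) a) (D-leading-shift k 0# v a)

  -- The sum of (X ^ suc k) ^ i * w ^ (n - i) over i ≤ n.
  geometric : ∀ k → Carrier → ∀ n → Vec Carrier (suc (n * suc k))
  geometric k w zero    = 1# ∷ []
  geometric k w (suc n) = shift k (w ^ᶠ suc n) (geometric k w n)

  -- A geometric sum in two quantities is the divided difference of a power at them, so the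
  -- recursion of `K` supplies the telescoping identity.
  D-zero-geometric : ∀ k w n a → D 0 a (geometric k w n) ≈ K (a ^ᶠ suc k ∷ w ∷ []) (suc (suc n))
  D-zero-geometric k w zero a = trans (+-congˡ (zeroʳ a)) (trans (+-identityʳ 1#) (sym (K-diagonal (a ^ᶠ suc k ∷ w ∷ []))))
  D-zero-geometric k w (suc n) a = begin
    D 0 a (shift k (w ^ᶠ suc n) (geometric k w n))          ≈⟨ D-zero-shift k _ (geometric k w n) a ⟩
    w ^ᶠ suc n +ᶠ a ^ᶠ suc k *ᶠ D 0 a (geometric k w n)     ≈⟨ +-comm _ _ ⟩
    a ^ᶠ suc k *ᶠ D 0 a (geometric k w n) +ᶠ w ^ᶠ suc n
      ≈⟨ +-cong (*-congˡ (D-zero-geometric k w n a)) (sym (K-singleton w (suc n))) ⟩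
    K (a ^ᶠ suc k ∷ w ∷ []) (suc (suc (suc n)))             ∎

  D-leading-geometric : ∀ k w n a → D (n * suc k) a (geometric k w n) ≈ 1#
  D-leading-geometric k w zero    a = trans (+-congˡ (zeroʳ a)) (+-identityʳ 1#)
  D-leading-geometric k w (suc n) a = trans (D-leading-shift k _ (geometric k w n) a) (D-leading-geometric k w n a)

  geometric-root : ∀ k w n a → ¬ (a ^ᶠ suc k ≈ w) → (a ^ᶠ suc k) ^ᶠ suc n ≈ w ^ᶠ suc n → D 0 a (geometric k w n) ≈ 0#
  geometric-root k w n a x≉w eq = trans (D-zero-geometric k w n a)
    (x*y≈0⇒y≈0 (λ x-w≈0 → x≉w (x-y≈0⇒x≈y x w x-w≈0)) (+-cancelʳ _ _ _ (begin
      (x -ᶠ w) *ᶠ K (x ∷ w ∷ []) (suc (suc n)) +ᶠ K (w ∷ []) (suc (suc n)) ≈⟨ K-difference [] (x-y+y≈x x w) (suc (suc n)) ⟩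
      K (x ∷ []) (suc (suc n))        ≈⟨ K-singleton x (suc n) ⟩
      x ^ᶠ suc n                      ≈⟨ eq ⟩
      w ^ᶠ suc n                      ≈⟨ K-singleton w (suc n) ⟨
      K (w ∷ []) (suc (suc n))        ≈⟨ +-identityˡ _ ⟨
      0# +ᶠ K (w ∷ []) (suc (suc n))  ∎)))
    where x = a ^ᶠ suc k

  geometric-roots≤ : ∀ k w n (xs : List Carrier) → AllPairs (λ x y → ¬ (x ≈ y)) xs →
    All (λ x → ¬ (x ^ᶠ suc k ≈ w) × (x ^ᶠ suc k) ^ᶠ suc n ≈ w ^ᶠ suc n) xs → length xs ≤ n * suc k
  geometric-roots≤ k w n xs distinct roots = roots≤degree (geometric k w n) xs distinct
    (All.map (λ {x} (x≉w , eq) → geometric-root k w n x x≉w eq) roots)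
    (λ a lead≈0 → 1≉0 (trans (sym (D-leading-geometric k w n a)) lead≈0))

-- Permutation arguments in a finite field.

module Finite {N : ℕ} {c ℓ : Level} (F : FiniteField (suc N) c ℓ) where
  open Polynomials F
  open FiniteField F hiding (zero) renaming (_+_ to infixl 6 _+ᶠ_; _*_ to infixl 7 _*ᶠ_; _-_ to infixl 6 _-ᶠ_)
  open Exp commutativeSemiring using (^-congˡ) renaming (_^_ to infixr 8 _^ᶠ_)
  open Mult semiring using (×-homo-+; ×1-homo-*; ×-assoc-*; ×-congʳ) renaming (_×_ to infixr 8 _×ᶠ_)
  open Group +-group using () renaming (∙-cancelʳ to +-cancelʳ; ∙-cancelˡ to +-cancelˡ)
  open Reasoning setoidF
  private
    module E = Inverse enumeration
    module ∑ = Sum +-commutativeMonoid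
    module ∏ = Sum *-commutativeMonoid

  from-injective : ∀ {x y} → E.from x ≡ E.from y → x ≈ y
  from-injective {x} {y} eq = trans (sym (E.strictlyInverseˡ x)) (trans (reflexive (cong E.to eq)) (E.strictlyInverseˡ y))

  _≈?_ : Binary.Decidable _≈_
  x ≈? y = map′ from-injective E.from-cong (E.from x Fin.≟ E.from y)

  to-injective : ∀ {i j} → E.to i ≈ E.to j → i ≡ j
  to-injective {i} {j} eq = ≡.trans (≡.sym (E.strictlyInverseʳ i)) (≡.trans (E.from-cong eq) (E.strictlyInverseʳ j))

  ^-≉0 : ∀ {x} n → ¬ (x ≈ 0#) → ¬ (x ^ᶠ n ≈ 0#)
  ^-≉0 zero    x≉0 = 1≉0
  ^-≉0 (suc n) x≉0 eq = ^-≉0 n x≉0 (x*y≈0⇒y≈0 x≉0 eq)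

  permute : (f g : Carrier → Carrier) → (∀ {x y} → x ≈ y → f x ≈ f y) → (∀ {x y} → x ≈ y → g x ≈ g y) →
    (∀ x → f (g x) ≈ x) → (∀ x → g (f x) ≈ x) → Permutation (suc N) (suc N)
  permute f g f-cong g-cong fg gf = permutation (λ i → E.from (f (E.to i))) (λ i → E.from (g (E.to i)))
    (λ i → ≡.trans (E.from-cong (trans (f-cong (E.strictlyInverseˡ _)) (fg _))) (E.strictlyInverseʳ i))
    (λ i → ≡.trans (E.from-cong (trans (g-cong (E.strictlyInverseˡ _)) (gf _))) (E.strictlyInverseʳ i))

  -- Translation by 1 permutes the field, so the sum of all elements equals itself plus `suc N`
  -- copies of 1.
  order×1≈0 : ι (suc N) ≈ 0#
  order×1≈0 = +-cancelˡ (∑.sum E.to) _ _ (begin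
    ∑.sum E.to +ᶠ ι (suc N)                            ≈⟨ +-congˡ (∑.sum-replicate (suc N)) ⟨
    ∑.sum E.to +ᶠ ∑.sum {suc N} (λ _ → 1#)             ≈⟨ ∑.∑-distrib-+ E.to (λ _ → 1#) ⟨
    ∑.sum (λ i → E.to i +ᶠ 1#)                         ≈⟨ ∑.sum-cong-≋ (λ i → E.strictlyInverseˡ (E.to i +ᶠ 1#)) ⟨
    ∑.sum (λ i → E.to (π ⟨$⟩ʳ i))                      ≈⟨ ∑.sum-permute E.to π ⟨
    ∑.sum E.to                                         ≈⟨ +-identityʳ _ ⟨
    ∑.sum E.to +ᶠ 0#                                   ∎)
    where
    π = permute (_+ᶠ 1#) (_-ᶠ 1#) +-congʳ +-congʳ (λ x → x-y+y≈x x 1#)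
      (λ x → trans (+-assoc x 1# (- 1#)) (trans (+-congˡ (-‿inverseʳ 1#)) (+-identityʳ x)))

  0ᵢ : Fin (suc N)
  0ᵢ = E.from 0#

  unit : Fin N → Carrier
  unit j = E.to (punchIn 0ᵢ j)

  unit≉0 : ∀ j → ¬ (unit j ≈ 0#)
  unit≉0 j eq = Fin.punchInᵢ≢i 0ᵢ j (≡.trans (≡.sym (E.strictlyInverseʳ _)) (E.from-cong eq))

  -- Multiplication by `z` permutes the units, so their product equals itself times `z ^ N`.
  fermat : ∀ {z} → ¬ (z ≈ 0#) → z ^ᶠ N ≈ 1#
  fermat {z} z≉0 with z⁻¹ , zz⁻¹≈1 ← inverse z z≉0 = *-cancelˡ-≉0 (product≉0 unit unit≉0) (begin
    ∏.sum unit *ᶠ z ^ᶠ N                       ≈⟨ *-congˡ (∏.sum-replicate N) ⟨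
    ∏.sum unit *ᶠ ∏.sum {N} (λ _ → z)          ≈⟨ *-comm _ _ ⟩
    ∏.sum {N} (λ _ → z) *ᶠ ∏.sum unit          ≈⟨ ∏.∑-distrib-+ (λ _ → z) unit ⟨
    ∏.sum (λ j → z *ᶠ unit j)                  ≈⟨ ∏.sum-cong-≋ unit-permuted ⟨
    ∏.sum (λ j → unit (remove 0ᵢ π ⟨$⟩ʳ j))    ≈⟨ ∏.sum-permute unit (remove 0ᵢ π) ⟨
    ∏.sum unit                                 ≈⟨ *-identityʳ _ ⟨
    ∏.sum unit *ᶠ 1#                           ∎)
    where
    product≉0 : ∀ {n} (f : Fin n → Carrier) → (∀ i → ¬ (f i ≈ 0#)) → ¬ (∏.sum f ≈ 0#)
    product≉0 {zero}  f f≉0 = 1≉0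
    product≉0 {suc n} f f≉0 eq = product≉0 (λ i → f (suc i)) (λ i → f≉0 (suc i)) (x*y≈0⇒y≈0 (f≉0 zero) eq)

    cancel : ∀ {u v} → u *ᶠ v ≈ 1# → ∀ x → u *ᶠ (v *ᶠ x) ≈ x
    cancel uv≈1 x = trans (sym (*-assoc _ _ x)) (trans (*-congʳ uv≈1) (*-identityˡ x))

    -- `π` acts on all indices and fixes that of zero; `remove 0ᵢ π` is its restriction to the
    -- units.
    π = permute (z *ᶠ_) (z⁻¹ *ᶠ_) *-congˡ *-congˡ (cancel zz⁻¹≈1) (cancel (trans (*-comm _ _) zz⁻¹≈1))

    π-fixes-0 : π ⟨$⟩ʳ 0ᵢ ≡ 0ᵢ
    π-fixes-0 = E.from-cong (trans (*-congˡ (E.strictlyInverseˡ 0#)) (zeroʳ z))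

    unit-permuted : ∀ j → unit (remove 0ᵢ π ⟨$⟩ʳ j) ≈ z *ᶠ unit j
    unit-permuted j = begin
      E.to (punchIn 0ᵢ (remove 0ᵢ π ⟨$⟩ʳ j))           ≡⟨ cong (λ i → E.to (punchIn i (remove 0ᵢ π ⟨$⟩ʳ j))) π-fixes-0 ⟨
      E.to (punchIn (π ⟨$⟩ʳ 0ᵢ) (remove 0ᵢ π ⟨$⟩ʳ j))  ≡⟨ cong E.to (punchIn-permute π 0ᵢ j) ⟨
      E.to (E.from (z *ᶠ unit j))                      ≈⟨ E.strictlyInverseˡ _ ⟩
      z *ᶠ unit j                                      ∎

  -- Characteristic `p` and the Frobenius map.

  module Characteristic {p : ℕ} (pr : Prime p) (e : ℕ) (order≡p^e : suc N ≡ p ^ e) where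

    -- The `e`-th power of `ι p` is the image of the field order, which is zero, and a field has no
    -- nonzero nilpotents.
    ι[p]≈0 : ι p ≈ 0#
    ι[p]≈0 with ι p ≈? 0#
    ... | yes eq = eq
    ... | no ι[p]≉0 = contradiction
      (trans (sym (ι-^ e)) (trans (reflexive (cong ι (≡.sym order≡p^e))) order×1≈0)) (^-≉0 e ι[p]≉0)
      where
      ι-^ : ∀ k → ι (p ^ k) ≈ ι p ^ᶠ k
      ι-^ zero    = +-identityʳ 1#
      ι-^ (suc k) = trans (×1-homo-* p (p ^ k)) (*-congˡ (ι-^ k))

    ∣⇒ι≈0 : ∀ {n} → p ∣ n → ι n ≈ 0#
    ∣⇒ι≈0 (divides m ≡.refl) = trans (×1-homo-* m p) (trans (*-congˡ ι[p]≈0) (zeroʳ _))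

    bézout-absurd : ∀ x y {m n} → ι m ≈ 0# → ι n ≈ 0# → ¬ (1 + x * m ≡ y * n)
    bézout-absurd x y {m} {n} m≈0 n≈0 eq = 1≉0 (begin
      1#             ≈⟨ +-identityʳ 1# ⟨
      1# +ᶠ 0#       ≈⟨ +-congˡ (trans (×1-homo-* x m) (trans (*-congˡ m≈0) (zeroʳ _))) ⟨
      ι (1 + x * m)  ≡⟨ cong ι eq ⟩
      ι (y * n)      ≈⟨ trans (×1-homo-* y n) (trans (*-congˡ n≈0) (zeroʳ _)) ⟩
      0#             ∎)

    -- A Bézout identity for the coprime numbers `p` and `n`, read in the field, would give 1 = 0.
    ∤⇒ι≉0 : ∀ {n} → ¬ (p ∣ n) → ¬ (ι n ≈ 0#)
    ∤⇒ι≉0 {n} p∤n ι[n]≈0 with coprime-Bézout p⊥n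
      where
      p⊥n : Coprime p n
      p⊥n (d∣p , d∣n) with prime⇒irreducible pr d∣p
      ... | inj₁ d≡1    = d≡1
      ... | inj₂ ≡.refl = contradiction d∣n p∤n
    ... | Bézout.+- x y eq = bézout-absurd y x ι[n]≈0 ι[p]≈0 eq
    ... | Bézout.-+ x y eq = bézout-absurd x y ι[p]≈0 ι[n]≈0 eq

    -- All inner binomial coefficients are divisible by `p`, by `p∣C`, so only the two end terms of
    -- the expansion remain.
    frobenius : ∀ n x y → (x +ᶠ y) ^ᶠ (p ^ n) ≈ x ^ᶠ (p ^ n) +ᶠ y ^ᶠ (p ^ n)
    frobenius n x y with p ^ n in p^n≡
    ... | zero  = contradiction p^n≡ (≢-nonZero⁻¹ (p ^ n) {{ℕ.m^n≢0 p n {{prime⇒nonZero pr}}}})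
    ... | suc m = begin
      (x +ᶠ y) ^ᶠ suc m            ≈⟨ Binomial.theorem commutativeSemiring (suc m) x y ⟩
      term zero +ᶠ ∑.sum (λ i → term (suc i))  ≈⟨ +-congˡ (∑.sum-init-last (λ i → term (suc i))) ⟩
      term zero +ᶠ (∑.sum (λ i → term (suc (inject₁ i))) +ᶠ term (suc (fromℕ m)))
        ≈⟨ +-cong first (+-cong (trans (∑.sum-cong-≋ middle) (∑.sum-replicate-zero m)) last) ⟩
      y ^ᶠ suc m +ᶠ (0# +ᶠ x ^ᶠ suc m)   ≈⟨ trans (+-congˡ (+-identityˡ _)) (+-comm _ _) ⟩
      x ^ᶠ suc m +ᶠ y ^ᶠ suc m           ∎
      where
      term = Binomial.binomialTerm commutativeSemiring x y (suc m)

      first : term zero ≈ y ^ᶠ suc m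
      first = begin
        (suc m C 0) ×ᶠ (1# *ᶠ y ^ᶠ suc m)  ≡⟨ cong (_×ᶠ (1# *ᶠ y ^ᶠ suc m)) (nC0≡1 (suc m)) ⟩
        1# *ᶠ y ^ᶠ suc m +ᶠ 0#             ≈⟨ trans (+-identityʳ _) (*-identityˡ _) ⟩
        y ^ᶠ suc m                         ∎

      last : term (suc (fromℕ m)) ≈ x ^ᶠ suc m
      last = begin
        term (suc (fromℕ m))
          ≡⟨ cong (λ k → (suc m C suc k) ×ᶠ (x ^ᶠ suc k *ᶠ y ^ᶠ (m ∸ k))) (Fin.toℕ-fromℕ m) ⟩
        (suc m C suc m) ×ᶠ (x ^ᶠ suc m *ᶠ y ^ᶠ (m ∸ m))
          ≡⟨ cong₂ (λ i k → i ×ᶠ (x ^ᶠ suc m *ᶠ y ^ᶠ k)) (nCn≡1 (suc m)) (ℕ.n∸n≡0 m) ⟩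
        x ^ᶠ suc m *ᶠ 1# +ᶠ 0#             ≈⟨ trans (+-identityʳ _) (*-identityʳ _) ⟩
        x ^ᶠ suc m                         ∎

      middle : ∀ i → term (suc (inject₁ i)) ≈ 0#
      middle i = begin
        C′ ×ᶠ w          ≈⟨ ×-congʳ C′ (*-identityˡ w) ⟨
        C′ ×ᶠ (1# *ᶠ w)  ≈⟨ ×-assoc-* C′ 1# w ⟨
        ι C′ *ᶠ w        ≈⟨ *-congʳ (∣⇒ι≈0 (p∣C pr n (suc m) k (∣-reflexive p^n≡) ℕ.0<1+n
                              (subst (k <_) (≡.sym p^n≡) (s<s (subst (_< m) (≡.sym (Fin.toℕ-inject₁ i)) (Fin.toℕ<n i)))))) ⟩
        0# *ᶠ w          ≈⟨ zeroˡ w ⟩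
        0#               ∎
        where
        k = suc (toℕ (inject₁ i))
        C′ = suc m C k
        w = Binomial.binomial commutativeSemiring x y (suc m) (suc (inject₁ i))

    -- Additivity is applied to the sum of `x - y` and `y`, which avoids evaluating a power of -1.
    frobenius-fixed-- : ∀ n {x y} → x ^ᶠ (p ^ n) ≈ x → y ^ᶠ (p ^ n) ≈ y → (x -ᶠ y) ^ᶠ (p ^ n) ≈ x -ᶠ y
    frobenius-fixed-- n {x} {y} fix-x fix-y = +-cancelʳ y _ _ (begin
      (x -ᶠ y) ^ᶠ (p ^ n) +ᶠ y              ≈⟨ +-congˡ fix-y ⟨
      (x -ᶠ y) ^ᶠ (p ^ n) +ᶠ y ^ᶠ (p ^ n)   ≈⟨ frobenius n (x -ᶠ y) y ⟨
      ((x -ᶠ y) +ᶠ y) ^ᶠ (p ^ n)            ≈⟨ ^-congˡ (p ^ n) (x-y+y≈x x y) ⟩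
      x ^ᶠ (p ^ n)                          ≈⟨ fix-x ⟩
      x                                     ≈⟨ x-y+y≈x x y ⟨
      x -ᶠ y +ᶠ y                           ∎)

-- The fixed points of x ↦ x^s in a field of order s², and the clique they provide.

module SquareOrder {N : ℕ} {c ℓ : Level} (F : FiniteField (suc N) c ℓ) (s-2 : ℕ)
  (order : N ≡ suc s-2 * suc (suc (suc s-2))) where
  open Polynomials F
  open Geometric F
  open Finite F
  open FiniteField F hiding (zero) renaming (_+_ to infixl 6 _+ᶠ_; _*_ to infixl 7 _*ᶠ_; _-_ to infixl 6 _-ᶠ_)
  open Exp commutativeSemiring using (^-congʳ; ^-assocʳ) renaming (_^_ to infixr 8 _^ᶠ_)
  private
    module E = Inverse enumeration
    module ≈-Reasoning = Reasoning setoidF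

    s : ℕ
    s = suc (suc s-2)

  Fixed : Fin (suc N) → Set ℓ
  Fixed i = E.to i ^ᶠ s ≈ E.to i

  fixed? : Decidable Fixed
  fixed? i = (E.to i ^ᶠ s) ≈? E.to i

  fixed : List (Fin (suc N))
  fixed = filter fixed? (allFin (suc N))

  norm-power : ∀ {x} → ¬ (x ≈ 0#) → (x ^ᶠ suc s-2) ^ᶠ suc s ≈ 1#
  norm-power {x} x≉0 = trans (^-assocʳ x (suc s-2) (suc s)) (trans (^-congʳ x (≡.sym order)) (fermat x≉0))

  1^n≈1 : ∀ n → 1# ^ᶠ n ≈ 1#
  1^n≈1 zero    = ≈-refl
  1^n≈1 (suc n) = trans (*-identityˡ _) (1^n≈1 n)

  -- Elements not fixed by x ↦ x ^ s are roots of (X ^ (q - 1) - 1) / (X ^ (s - 1) - 1),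
  -- which has degree q - s.
  s≤length-fixed : s ≤ length fixed
  s≤length-fixed = ℕ.+-cancelʳ-≤ (s * suc s-2) s (length fixed) (begin
    s + s * suc s-2                       ≡⟨ square s-2 ⟩
    suc (suc s-2 * suc s)                 ≡⟨ cong suc order ⟨
    suc N                                 ≡⟨ length-tabulate {n = suc N} (λ i → i) ⟨
    length (allFin (suc N))               ≡⟨ length-filter+length-filter-¬ fixed? (allFin (suc N)) ⟨
    length fixed + length moved           ≡⟨ cong (length fixed +_) (length-map E.to moved) ⟨
    length fixed + length (map E.to moved)
      ≤⟨ ℕ.+-monoʳ-≤ (length fixed) (geometric-roots≤ s-2 1# s (map E.to moved)
           (AllPairs.map⁺ (AllPairs.map (λ i≢j eq → i≢j (to-injective eq)) (Unique.filter⁺ moved? (Unique.allFin⁺ (suc N)))))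
           (All.map⁺ (All.map moved-root (All.all-filter moved? (allFin (suc N)))))) ⟩
    length fixed + s * suc s-2            ∎)
    where
    open ℕ.≤-Reasoning
    moved? = λ i → ¬? (fixed? i)
    moved = filter moved? (allFin (suc N))

    square : ∀ m → suc (suc m) + suc (suc m) * suc m ≡ suc (suc m * suc (suc (suc m)))
    square = solve-∀

    moved-root : ∀ {i} → ¬ Fixed i → let x = E.to i in
      ¬ (x ^ᶠ suc s-2 ≈ 1#) × (x ^ᶠ suc s-2) ^ᶠ suc s ≈ 1# ^ᶠ suc s
    moved-root {i} x^s≉x =
      (λ eq → x^s≉x (trans (*-congˡ eq) (*-identityʳ _))) ,
      -- Zero is fixed, so a moved element is a unit.
      trans (norm-power λ x≈0 → x^s≉x (trans (*-congʳ x≈0) (trans (zeroˡ _) (sym x≈0)))) (sym (1^n≈1 (suc s)))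

  -- Otherwise all q - 1 units would be roots of the polynomial
  -- (X ^ (q - 1) - 1) / (X ^ (s + 1) - w), of degree q - s - 2.
  norm-surjective : ∀ {w} → w ^ᶠ suc s-2 ≈ 1# → ∃ λ z → ¬ (z ≈ 0#) × w ≈ z ^ᶠ suc s
  norm-surjective {w} w^[s-1]≈1 with Fin.any? (λ j → w ≈? (unit j ^ᶠ suc s))
  ... | yes (j , eq) = unit j , unit≉0 j , eq
  ... | no none = contradiction
    (subst (_≤ s-2 * suc s) (≡.trans (length-tabulate unit) order)
      (geometric-roots≤ s w s-2 (tabulate unit)
        (AllPairs.tabulate⁺ λ i≢j eq → i≢j (Fin.punchIn-injective 0ᵢ _ _ (to-injective eq)))
        (All.tabulate⁺ λ j → (λ eq → none (j , sym eq)) , (begin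
          (unit j ^ᶠ suc s) ^ᶠ suc s-2   ≈⟨ ^-assocʳ (unit j) (suc s) (suc s-2) ⟩
          unit j ^ᶠ (suc s * suc s-2)    ≡⟨ cong (unit j ^ᶠ_) (≡.trans (ℕ.*-comm (suc s) (suc s-2)) (≡.sym order)) ⟩
          unit j ^ᶠ N                    ≈⟨ fermat (unit≉0 j) ⟩
          1#                             ≈⟨ w^[s-1]≈1 ⟨
          w ^ᶠ suc s-2                   ∎))))
    (ℕ.<⇒≱ (ℕ.m<n+m (s-2 * suc s) ℕ.0<1+n))
    where open ≈-Reasoning

  fixed-family : ∃ λ (f : Fin s → Fin (suc N)) → (∀ i j → f i ≡ f j → i ≡ j) × (∀ i → Fixed (f i))
  fixed-family = distinct-members fixed (Unique.filter⁺ fixed? (Unique.allFin⁺ (suc N)))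
    (All.all-filter fixed? (allFin (suc N))) s≤length-fixed

  -- A difference `w` of two members is again fixed, and cancelling `w` gives `w ^ (s - 1) = 1`.
  -- Then `norm-surjective` yields `w = z ^ (s + 1)`, and `s + 1 = m * d` makes this the `d`-th
  -- power of `z ^ m`.
  subfield-clique : ∀ {p e n d} → Prime p → suc N ≡ p ^ e → s ≡ p ^ n → d ∣ suc s → Clique (GP F d) s
  subfield-clique {p} {e} {n} {d} pr order≡p^e s≡p^n (divides m 1+s≡m*d) = record
    { members = record
      { to        = member
      ; cong      = λ { ≡.refl → ≈-refl }
      ; injective = member-injective
      }
    ; adjacent = λ i j i≢j → (λ eq → i≢j (member-injective eq)) , difference i j i≢j
    }
    where
    open Characteristic pr e order≡p^e

    member : Fin s → Carrier
    member i = E.to (proj₁ fixed-family i)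

    member-fixed : ∀ i → member i ^ᶠ (p ^ n) ≈ member i
    member-fixed i = subst (λ k → member i ^ᶠ k ≈ member i) s≡p^n (proj₂ (proj₂ fixed-family) i)

    member-injective : ∀ {i j} → member i ≈ member j → i ≡ j
    member-injective {i} {j} eq = proj₁ (proj₂ fixed-family) i j (to-injective eq)

    difference-power : ∀ i j → i ≢ j → (member i -ᶠ member j) ^ᶠ suc s-2 ≈ 1#
    difference-power i j i≢j =
      *-cancelˡ-≉0 (λ w≈0 → i≢j (member-injective (Group.x∙y⁻¹≈ε⇒x≈y +-group _ _ w≈0))) (begin
        w *ᶠ w ^ᶠ suc s-2  ≡⟨ cong (w ^ᶠ_) s≡p^n ⟩
        w ^ᶠ (p ^ n)       ≈⟨ frobenius-fixed-- n (member-fixed i) (member-fixed j) ⟩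
        w                  ≈⟨ *-identityʳ w ⟨
        w *ᶠ 1#            ∎)
      where
      open ≈-Reasoning
      w = member i -ᶠ member j

    norm⇒power : ∀ {w} → (∃ λ z → ¬ (z ≈ 0#) × w ≈ z ^ᶠ suc s) → IsUnitPower F d w
    norm⇒power (z , z≉0 , eq) = z ^ᶠ m , ^-≉0 m z≉0 ,
      trans eq (trans (^-congʳ z 1+s≡m*d) (sym (^-assocʳ z m d)))

    difference : ∀ i j → i ≢ j → IsUnitPower F d (member i -ᶠ member j)
    difference i j i≢j = norm⇒power (norm-surjective (difference-power i j i≢j))

-- Cliques with at least √q vertices.

module Cliques {N : ℕ} {c ℓ : Level} (F : FiniteField (suc N) c ℓ) where
  open Polynomials F
  open Finite F
  open Stepanov F
  open FiniteField F using (commutativeSemiring; _≈_; 0#; 1#; trans)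
  open Exp commutativeSemiring using (^-congˡ; ^-congʳ; ^-assocʳ) renaming (_^_ to infixr 8 _^ᶠ_)

  unitPower⇒root-of-unity : ∀ {d h x} → N ≡ h * d → IsUnitPower F d x → x ^ᶠ h ≈ 1#
  unitPower⇒root-of-unity {d} {h} N≡hd (z , z≉0 , eq) = trans (^-congˡ h eq)
    (trans (^-assocʳ z d h) (trans (^-congʳ z (≡.trans (ℕ.*-comm d h) (≡.sym N≡hd))) (fermat z≉0)))

  -- Serves every claim of the theorem: it caps cliques at `s` and extracts the divisibility from
  -- any clique that reaches `s`.
  large-clique : ∀ {p n d h s} → Prime p → 1 < d → s ≡ p ^ n → 1 < s → suc N ≡ s * s → N ≡ h * d →
    ∀ {M} → Clique (GP F d) M → s ≤ M → M ≡ s × d ∣ suc s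
  large-clique {p} {n} {d} {h} {s} pr 1<d s≡p^n 1<s order N≡hd clique s≤M
    with k , t , k<s , complement ← ∃-complement h s (ℕ.<-trans ℕ.0<1+n 1<s)
    -- `M` splits as `suc k + l` because `suc k ≤ s ≤ M`.
    with l , ≡.refl ← ℕ.m≤n⇒∃[o]m+o≡n (ℕ.≤-trans k<s s≤M)
    = extremal-arithmetic {t = t} 1<d 1<s (≡.trans (cong suc (≡.sym N≡hd)) order) complement
        (stepanov h k l (Injection.to members) 0<h
          (λ i j i≢j eq → i≢j (Injection.injective members eq))
          (λ i j i≢j → unitPower⇒root-of-unity {d} {h} N≡hd (proj₂ (adjacent i j i≢j)))
          lead≉0)
        s≤M
    where
    open Clique clique
    open Characteristic pr (n + n) (≡.trans order (≡.trans (cong₂ _*_ s≡p^n s≡p^n) (≡.sym (ℕ.^-distribˡ-+-* p n n))))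

    0<h : 0 < h
    0<h = ℕ.n≢0⇒n>0 λ h≡0 → ℕ.<-irrefl
      (≡.trans (cong suc (≡.sym (≡.trans N≡hd (cong (_* d) h≡0)))) order) (ℕ.*-mono-< 1<s 1<s)

    -- By symmetry the coefficient is `(h + k) C k`. Its upper index is one below a multiple of
    -- `p ^ n` and `k < p ^ n`, so `p∤C` applies.
    lead≉0 : ¬ (ι ((h + k) C h) ≈ 0#)
    lead≉0 = ∤⇒ι≉0 (subst (λ x → ¬ (p ∣ x)) (≡.sym (≡.trans (nCk≡nC[n∸k] (ℕ.m≤m+n h k)) (cong ((h + k) C_) (ℕ.m+n∸m≡n h k))))
      (p∤C pr n (h + k) k (divides t (≡.trans (≡.sym (ℕ.+-suc h k)) (≡.trans complement (cong (t *_) s≡p^n))))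
        (subst (k <_) s≡p^n k<s)))

-- Disposes of the degenerate orders, so that the main case has `√q` at least 2.
order>1 : ∀ {q c ℓ} → FiniteField q c ℓ → 1 < q
order>1 {zero} F with () ← Inverse.from (FiniteField.enumeration F) (FiniteField.0# F)
order>1 {suc zero} F = contradiction (from-injective (Fin1-irrelevant _ _)) 1≉0
  where
  open FiniteField F using (1≉0)
  open Finite F
  Fin1-irrelevant : ∀ (i j : Fin 1) → i ≡ j
  Fin1-irrelevant zero zero = ≡.refl
order>1 {suc (suc _)} F = s<s ℕ.0<1+n

theorem1p6 : ∀ {c ℓ : Level} (p d q √q : ℕ) → Prime p → ¬ (2 ∣ p) → 1 < d →
    (∃ λ n → q ≡ p ^ (2 * n)) → √q * √q ≡ q → 2 * d ∣ ∣ q - 1 ∣ →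
    (F : FiniteField q c ℓ) →
    (ω (GP F d) ≡ √q ⇔ d ∣ √q + 1) × (¬ (d ∣ √q + 1) → ω (GP F d) ≤ √q ∸ 1)
theorem1p6 p d zero √q pr _ 1<d _ _ _ F with () ← order>1 F
theorem1p6 p d (suc N) zero pr _ 1<d _ () _ F
theorem1p6 p d (suc N) (suc zero) pr _ 1<d _ ≡.refl _ F with s≤s () ← order>1 F
theorem1p6 p d (suc N) s@(suc (suc s-2)) pr _ 1<d (n , q≡p^2n) s*s≡q (divides m N≡m*2d) F =
  -- Everything reduces to `s ≤ ω`: equality gives it at once, the subfield clique gives it by
  -- maximality of `ω`, and its failure is `ω ≤ s - 1`.
  mk⇔ (λ ω≡s → subst (d ∣_) 1+s≡s+1 (proj₂ (large (ℕ.≤-reflexive (≡.sym ω≡s)))))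
      (λ d∣s+1 → proj₁ (large (proj₂ ω-spec s
        (subfield-clique {e = 2 * n} {n = n} pr q≡p^2n s≡p^n (subst (d ∣_) (≡.sym 1+s≡s+1) d∣s+1))))) ,
  (λ d∤s+1 → s≤s⁻¹ (ℕ.≰⇒> λ s≤ω → d∤s+1 (subst (d ∣_) 1+s≡s+1 (proj₂ (large s≤ω)))))
  where
  ω-spec = ω-isCliqueNumber (GP F d)

  1+s≡s+1 : suc s ≡ s + 1
  1+s≡s+1 = ℕ.+-comm 1 s

  s≡p^n : s ≡ p ^ n
  s≡p^n = square-injective (≡.trans s*s≡q (≡.trans q≡p^2n
    (≡.trans (cong (p ^_) (cong (n +_) (ℕ.+-identityʳ n))) (ℕ.^-distribˡ-+-* p n n))))

  N≡[s-1][s+1] : N ≡ suc s-2 * suc s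
  N≡[s-1][s+1] = ℕ.suc-injective (≡.trans (≡.sym s*s≡q) (square s-2))
    where
    square : ∀ r → suc (suc r) * suc (suc r) ≡ suc (suc r * suc (suc (suc r)))
    square = solve-∀

  open SquareOrder F s-2 N≡[s-1][s+1] using (subfield-clique)

  large : s ≤ ω (GP F d) → ω (GP F d) ≡ s × d ∣ suc s
  -- The exponent `h` is `m * 2`, as q - 1 is `m * (2 * d)`; the distance `∣ suc N - 1 ∣` computes
  -- to `∣ N - 0 ∣`.
  large = Cliques.large-clique F {n = n} {h = m * 2} pr 1<d s≡p^n (s<s ℕ.0<1+n) (≡.sym s*s≡q)
    (≡.trans (≡.sym (ℕ.∣-∣-identityʳ N)) (≡.trans N≡m*2d (≡.sym (ℕ.*-assoc m 2 d)))) (proj₁ ω-spec)
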